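{- There exists an oracle $\mathcal{V}\subseteq\mathbb{N}$ such that, relative to $\mathcal{V}$, there is no disjoint $\mathsf{CoNP}$ pair that is complete for the class of disjoint $\mathsf{CoNP}$ pairs with respect to polynomial-time reductions, but $\mathsf{E}^{\mathcal{V}}=\mathsf{NE}^{\mathcal{V}}$.
   Context: Relative to an oracle $A$: a disjoint $\mathsf{CoNP}^A$ pair is a pair $(U,V)$ of $\mathsf{CoNP}^A$ sets with $U\cap V=\varnothing$. $(U_0,U_1)$ is polynomially reducible to $(U'_0,U'_1)$ if there is a function $f$ computable in polynomial time with oracle $A$ such that for $i\in\{0,1\}$ and all $n$, $n\in U_i\to f(n)\in U'_i$. A pair is complete if every disjoint $\mathsf{CoNP}^A$ pair reduces to it. $\mathsf{E}^A$ and $\mathsf{NE}^A$ are the classes of languages decidable by deterministic, resp. nondeterministic, oracle machines with oracle $A$ in time $2^{O(n)}$ ($n$ the input length). -}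

module Defs where

open import Data.Nat using (ℕ; zero; suc; _+_; _*_; _^_; _≤_)
open import Data.Bool using (Bool; true; false)
open import Data.Fin using (Fin)
open import Data.List using (List; []; _∷_; length; reverse; _++_)
open import Data.List.Membership.Propositional using (_∈_)
open import Data.Product using (Σ; ∃; _×_; _,_)
open import Relation.Binary.PropositionalEquality using (_≡_)
open import Relation.Nullary using (¬_)
open import Function.Bundles using (_⇔_)

-- Encoding of natural numbers as binary words (bijective base-2,
-- little-endian).  decode [] = 0, decode (false ∷ w) = 1 + 2·decode w,
-- decode (true ∷ w) = 2 + 2·decode w;  encode is its inverse.

decode : List Bool → ℕ
decode []          = 0
decode (false ∷ w) = 1 + 2 * decode w
decode (true  ∷ w) = 2 + 2 * decode w

inc : List Bool → List Bool
inc []          = false ∷ []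
inc (false ∷ w) = true ∷ w
inc (true  ∷ w) = false ∷ inc w

encode : ℕ → List Bool
encode zero    = []
encode (suc n) = inc (encode n)

∣_∣ : ℕ → ℕ
∣ n ∣ = length (encode n)

data Sym : Set where
  blank b0 b1 : Sym

bit : Bool → Sym
bit false = b0
bit true  = b1

data Move : Set where
  L R S : Move

data Kind : Set where
  normal accept reject query : Kind

-- a two-way infinite tape: cells left of the head (nearest first),
-- the scanned cell, and cells right of the head
record Tape : Set where
  constructor tape
  field
    left  : List Sym
    here  : Sym
    right : List Sym

blankTape : Tape
blankTape = tape [] blank []

write : Sym → Tape → Tape
write s (tape l _ r) = tape l s r

move : Move → Tape → Tape
move L (tape []      h r) = tape [] blank (h ∷ r)
move L (tape (x ∷ l) h r) = tape l x (h ∷ r)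
move R (tape l h [])      = tape (h ∷ l) blank []
move R (tape l h (x ∷ r)) = tape (h ∷ l) x r
move S t = t

readBits : List Sym → List Bool
readBits []         = []
readBits (blank ∷ _) = []
readBits (b0 ∷ s)   = false ∷ readBits s
readBits (b1 ∷ s)   = true ∷ readBits s

bitsOf : List Sym → List Bool
bitsOf []          = []
bitsOf (blank ∷ s) = bitsOf s
bitsOf (b0 ∷ s)    = false ∷ bitsOf s
bitsOf (b1 ∷ s)    = true ∷ bitsOf s

queryWord : Tape → List Bool
queryWord (tape l h r) = bitsOf (reverse l ++ (h ∷ r))

record OTM : Set where
  field
    nQ    : ℕ
    start : Fin nQ
    kind  : Fin nQ → Kind
    -- transitions of a normal state: given the scanned work and oracle
    -- symbols, the list of possible (next state, work symbol written,
    -- work move, oracle symbol written, oracle move)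
    δ     : Fin nQ → Sym → Sym →
            List (Fin nQ × Sym × Move × Sym × Move)
    ans   : Fin nQ → Bool → Fin nQ

open OTM public

Deterministic : OTM → Set
Deterministic M = ∀ q a b → length (δ M q a b) ≤ 1

record Config (M : OTM) : Set where
  constructor config
  field
    state  : Fin (nQ M)
    work   : Tape
    oracle : Tape

initTape : List Bool → Tape
initTape []      = blankTape
initTape (b ∷ w) = tape [] (bit b) (Data.List.map bit w)

init : (M : OTM) → ℕ → Config M
init M n = config (start M) (initTape (encode n)) blankTape

data Step (M : OTM) (A : ℕ → Bool) : Config M → Config M → Set where
  normalStep : ∀ {q w o q' sw mw so mo} →
    kind M q ≡ normal →
    (q' , sw , mw , so , mo) ∈ δ M q (Tape.here w) (Tape.here o) →
    Step M A (config q w o)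
             (config q' (move mw (write sw w)) (move mo (write so o)))
  queryStep : ∀ {q w o} →
    kind M q ≡ query →
    Step M A (config q w o)
             (config (ans M q (A (decode (queryWord o)))) w blankTape)

data Steps (M : OTM) (A : ℕ → Bool) : ℕ → Config M → Config M → Set where
  done : ∀ {c} → Steps M A zero c c
  step : ∀ {t c c' c''} → Step M A c c' → Steps M A t c' c'' →
         Steps M A (suc t) c c''

Accepts : (M : OTM) → (ℕ → Bool) → ℕ → Set
Accepts M A n = ∃ λ t → ∃ λ c →
  Steps M A t (init M n) c × kind M (Config.state c) ≡ accept

TimeBound : OTM → (ℕ → Bool) → (ℕ → ℕ) → Set
TimeBound M A T = ∀ n c → ¬ Steps M A (suc (T ∣ n ∣)) (init M n) c

PolyTime : OTM → (ℕ → Bool) → Set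
PolyTime M A = ∃ λ k → TimeBound M A (λ m → m ^ k + k)

-- time 2^{O(n)}
ExpTime : OTM → (ℕ → Bool) → Set
ExpTime M A = ∃ λ c → TimeBound M A (λ m → 2 ^ (c * (m + 1)))

Lang : Set₁
Lang = ℕ → Set

InNP : (ℕ → Bool) → Lang → Set
InNP A U = Σ OTM λ M → PolyTime M A × (∀ n → U n ⇔ Accepts M A n)

InCoNP : (ℕ → Bool) → Lang → Set
InCoNP A U = Σ OTM λ M → PolyTime M A × (∀ n → U n ⇔ (¬ Accepts M A n))

InE : (ℕ → Bool) → Lang → Set
InE A U = Σ OTM λ M → Deterministic M × ExpTime M A ×
          (∀ n → U n ⇔ Accepts M A n)

InNE : (ℕ → Bool) → Lang → Set
InNE A U = Σ OTM λ M → ExpTime M A × (∀ n → U n ⇔ Accepts M A n)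

FP : (ℕ → Bool) → (ℕ → ℕ) → Set
FP A f = Σ OTM λ M → Deterministic M × PolyTime M A ×
  (∀ n → ∃ λ t → ∃ λ c → Steps M A t (init M n) c ×
     kind M (Config.state c) ≡ accept ×
     readBits (Tape.here (Config.work c) ∷ Tape.right (Config.work c))
       ≡ encode (f n))

DisjointCoNPPair : (ℕ → Bool) → Lang → Lang → Set
DisjointCoNPPair A U V = InCoNP A U × InCoNP A V × (∀ n → ¬ (U n × V n))

Reduces : (ℕ → Bool) → Lang → Lang → Lang → Lang → Set
Reduces A U₀ U₁ U₀' U₁' = Σ (ℕ → ℕ) λ f → FP A f ×
  (∀ n → U₀ n → U₀' (f n)) × (∀ n → U₁ n → U₁' (f n))

CompletePair : (ℕ → Bool) → Lang → Lang → Set₁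
CompletePair A U V = DisjointCoNPPair A U V ×
  (∀ U' V' → DisjointCoNPPair A U' V' → Reduces A U' V' U V)

{-# OPTIONS --safe #-}
module Submission where

-- The oracle answers two kinds of queries.  A simulation query (e, w, 1^t) asks
-- whether machine e accepts w within t steps.  It is longer than t, so its answer
-- depends on shorter queries only, and a deterministic machine can write it down
-- in time 2^O(n), whence E = NE.  It is admitted only if the number coded by w is
-- at most its length, so polynomially many of them have polynomial length.
--
-- The remaining bits are free.  The block of a word v consists of the bits
-- (i, v, y) with i in {0, 1} and |y| = |v|.  A pair of coNP machines with index g
-- is compared with the pair of sets P' i of those n for which all bits
-- (i, tag g n, y) are false.  Given also a reduction F, a stage reserves few free
-- bits that decide all short simulation queries (each is made true if possible,
-- which takes one accepting path), picks an n with an unreserved block, makes this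
-- block false and looks at x = F(n).  If both machines reject x, their pair is not
-- disjoint.  Otherwise machine i accepts x on a path with few queries; keeping
-- their answers and making the rest of side 1 - i true puts n into P' i, while x
-- is not in the i-th set of the given pair.  All other blocks keep a true bit, so
-- P' is disjoint unless the given pair is not.  A stage is a finite search, which
-- makes the oracle computable although the forcing argument is classical.

open import Defs
open import Data.Bool using (Bool; true; false)
import Data.Bool.Properties as Bool
open import Data.Empty using (⊥; ⊥-elim)
open import Data.Fin using (Fin; zero; suc; toℕ; fromℕ; inject₁)
open import Data.Fin.Patterns using (0F; 1F; 2F; 3F)
open import Data.Fin.Properties using (toℕ-fromℕ; toℕ-inject₁)
open import Data.List using (List; []; _∷_; length; map; _++_; drop; filter; upTo; reverse; _ʳ++_; cartesianProduct; cartesianProductWith)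
open import Data.List.Properties using (≡-dec; ∷-injectiveʳ; map-id; length-map; length-++; length-filter; length-upTo; length-reverse; ++-assoc; ++-identityʳ; reverse-map; ʳ++-defn; ʳ++-ʳ++)
open import Data.List.Membership.Propositional using (_∈_; _∉_; lose; find)
open import Data.List.Membership.Propositional.Properties using (∈-map⁺; ∈-map⁻; ∈-filter⁺; ∈-filter⁻; ∈-upTo⁺; ∈-cartesianProduct⁺; ∈-cartesianProductWith⁺)
open import Data.List.Relation.Unary.All as All using (All; []; _∷_)
open import Data.List.Relation.Unary.All.Properties using (++⁺; ++⁻; ++⁻ˡ; ++⁻ʳ; filter⁺)
open import Data.List.Relation.Unary.Any using (Any; here; there; any?)
open import Data.Maybe using (Maybe; just; nothing)
open import Data.Nat
open import Data.Nat.Properties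
open import Data.Nat.Solver using (module +-*-Solver)
open import Data.Product using (Σ; ∃; _×_; _,_; proj₁; proj₂; map₁)
open import Data.Sum as Sum using (_⊎_; inj₁; inj₂)
open import Function using (_∘_)
open import Function.Bundles using (_⇔_; mk⇔; Equivalence)
open import Relation.Binary.PropositionalEquality
open import Relation.Nullary using (¬_; Dec; yes; no; does)
open import Relation.Nullary.Decidable using (map′; does-⇔; dec-true; dec-false; decidable-stable; ¬¬-excluded-middle; ¬?; _×-dec_)

-- Words and codes of machines

Word : Set
Word = List Bool

encode-odd : ∀ k → encode (1 + 2 * k) ≡ false ∷ encode k
encode-odd zero    = refl
encode-odd (suc k) rewrite +-suc k (k + 0) | encode-odd k = refl

encode-even : ∀ k → encode (2 + 2 * k) ≡ true ∷ encode k
encode-even k = cong inc (encode-odd k)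

encode-decode : ∀ w → encode (decode w) ≡ w
encode-decode []          = refl
encode-decode (false ∷ w) = trans (encode-odd (decode w)) (cong (false ∷_) (encode-decode w))
encode-decode (true  ∷ w) = trans (encode-even (decode w)) (cong (true ∷_) (encode-decode w))

length≤decode : ∀ w → length w ≤ decode w
length≤decode []          = z≤n
length≤decode (false ∷ w) = s≤s (≤-trans (length≤decode w) (m≤m+n _ _))
length≤decode (true  ∷ w) = s≤s (≤-trans (length≤decode w) (≤-trans (m≤m+n _ _) (n≤1+n _)))

decode-bound : ∀ w → 2 + decode w ≤ 2 ^ suc (length w)
decode-bound []      = s≤s (s≤s z≤n)
decode-bound (b ∷ w) = ≤-trans (le b) (*-monoʳ-≤ 2 (decode-bound w))
  where
  le : ∀ b → 2 + decode (b ∷ w) ≤ 2 * (2 + decode w)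
  le true  = ≤-reflexive (sym (*-distribˡ-+ 2 2 (decode w)))
  le false = ≤-trans (n≤1+n _) (le true)

n<2^n : ∀ n → n < 2 ^ n
n<2^n zero    = s≤s z≤n
n<2^n (suc n) = ≤-trans (+-mono-≤ (m^n>0 2 n) (n<2^n n)) (+-monoʳ-≤ (2 ^ n) (m≤m+n _ 0))

bump : List ℕ → List ℕ
bump []       = []
bump (n ∷ ns) = suc n ∷ ns

-- A word is read as a list of unary numbers: each `false` closes a block of ones, and the last
-- block stays open. This open block is the trailing 0 in `split-join`.
split : Word → List ℕ
split []          = 0 ∷ []
split (false ∷ w) = 0 ∷ split w
split (true  ∷ w) = bump (split w)

ones : ℕ → Word → Word
ones zero    w = w
ones (suc n) w = true ∷ ones n w

length-ones : ∀ n w → length (ones n w) ≡ n + length w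
length-ones zero    w = refl
length-ones (suc n) w = cong suc (length-ones n w)

split-block : ∀ n w → split (ones n (false ∷ w)) ≡ n ∷ split w
split-block zero    w = refl
split-block (suc n) w rewrite split-block n w = refl

split-ones : ∀ n → split (ones n []) ≡ n ∷ []
split-ones zero    = refl
split-ones (suc n) rewrite split-ones n = refl

join : List ℕ → Word
join []       = []
join (n ∷ ns) = ones n (false ∷ join ns)

split-join : ∀ ns → split (join ns) ≡ ns ++ 0 ∷ []
split-join []       = refl
split-join (n ∷ ns) rewrite split-block n (join ns) | split-join ns = refl

unpairW : List ℕ → ℕ × ℕ
unpairW (a ∷ b ∷ _) = a , b
unpairW _           = 0 , 0

abstract
  unpair : ℕ → ℕ × ℕ
  unpair e = unpairW (split (encode e))

  pair : ℕ → ℕ → ℕ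
  pair a b = decode (join (a ∷ b ∷ []))

  unpair-pair : ∀ a b → unpair (pair a b) ≡ (a , b)
  unpair-pair a b rewrite encode-decode (join (a ∷ b ∷ [])) | split-join (a ∷ b ∷ []) = refl

  pair≥₂ : ∀ a b → b ≤ pair a b
  pair≥₂ a b = ≤-trans lem (length≤decode (join (a ∷ b ∷ [])))
    where
    lem : b ≤ length (join (a ∷ b ∷ []))
    lem rewrite length-ones a (false ∷ ones b (false ∷ [])) | length-ones b (false ∷ []) =
      ≤-trans (m≤m+n b 1) (≤-trans (n≤1+n _) (m≤n+m _ a))

-- Numerical codes of finite data

record EnumUpTo (A : Set) (_~_ : A → A → Set) : Set where
  field
    dec  : ℕ → A
    code : A → ℕ
    -- Only up to a relation: a decoded function agrees pointwise with the given one, and function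
    -- extensionality is not assumed.
    dec-code : ∀ a → dec (code a) ~ a

open EnumUpTo

Enum : Set → Set
Enum A = EnumUpTo A _≡_

clamp : ∀ n → ℕ → Fin (suc n)
clamp _       zero    = zero
clamp zero    (suc e) = zero
clamp (suc n) (suc e) = suc (clamp n e)

clamp-toℕ : ∀ n i → clamp n (toℕ i) ≡ i
clamp-toℕ n       zero    = refl
clamp-toℕ (suc n) (suc i) = cong suc (clamp-toℕ n i)

enumFin : ∀ n → Enum (Fin (suc n))
enumFin n = record { dec = clamp n ; code = toℕ ; dec-code = clamp-toℕ n }

enumMap : ∀ {A B : Set} (f : A → B) (g : B → A) → (∀ b → f (g b) ≡ b) → Enum A → Enum B
enumMap f g fg E .dec        = f ∘ dec E
enumMap f g fg E .code       = code E ∘ g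
enumMap f g fg E .dec-code b = trans (cong f (dec-code E (g b))) (fg b)

toSym : Fin 3 → Sym
toSym 0F = blank
toSym 1F = b0
toSym 2F = b1

fromSym : Sym → Fin 3
fromSym blank = 0F
fromSym b0    = 1F
fromSym b1    = 2F

enumSym : Enum Sym
enumSym = enumMap toSym fromSym (λ { blank → refl ; b0 → refl ; b1 → refl }) (enumFin 2)

enumMove : Enum Move
enumMove = enumMap (λ { 0F → L ; 1F → R ; 2F → S }) (λ { L → 0F ; R → 1F ; S → 2F })
                   (λ { L → refl ; R → refl ; S → refl }) (enumFin 2)

enumKind : Enum Kind
enumKind = enumMap (λ { 0F → normal ; 1F → accept ; 2F → reject ; 3F → query })
                   (λ { normal → 0F ; accept → 1F ; reject → 2F ; query → 3F })
                   (λ { normal → refl ; accept → refl ; reject → refl ; query → refl }) (enumFin 3)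

enumProd : ∀ {A B : Set} → Enum A → Enum B → Enum (A × B)
enumProd E F .dec e = dec E (proj₁ (unpair e)) , dec F (proj₂ (unpair e))
enumProd E F .code (a , b) = pair (code E a) (code F b)
enumProd E F .dec-code (a , b)
  rewrite unpair-pair (code E a) (code F b) | dec-code E a | dec-code F b = refl

module _ {A : Set} (E : Enum A) where

  decList : ℕ → ℕ → List A
  decList zero    e = []
  decList (suc n) e = dec E (proj₁ (unpair e)) ∷ decList n (proj₂ (unpair e))

  codeList : List A → ℕ
  codeList []       = 0
  codeList (a ∷ as) = pair (code E a) (codeList as)

  decList-codeList : ∀ as → decList (length as) (codeList as) ≡ as
  decList-codeList []       = refl
  decList-codeList (a ∷ as) rewrite unpair-pair (code E a) (codeList as) =
    cong₂ _∷_ (dec-code E a) (decList-codeList as)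

  -- The length is stored as well, because `codeList` alone does not show where the list ends.
  enumList : Enum (List A)
  enumList .dec e   = decList (proj₁ (unpair e)) (proj₂ (unpair e))
  enumList .code as = pair (length as) (codeList as)
  enumList .dec-code as rewrite unpair-pair (length as) (codeList as) = decList-codeList as

module _ {A : Set} {_~_ : A → A → Set} (E : EnumUpTo A _~_) where

  decFun : ∀ n → ℕ → Fin n → A
  decFun (suc n) e zero    = dec E (proj₁ (unpair e))
  decFun (suc n) e (suc i) = decFun n (proj₂ (unpair e)) i

  codeFun : ∀ n → (Fin n → A) → ℕ
  codeFun zero    f = 0
  codeFun (suc n) f = pair (code E (f zero)) (codeFun n (f ∘ suc))

  decFun-codeFun : ∀ n f i → decFun n (codeFun n f) i ~ f i
  decFun-codeFun (suc n) f zero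
    rewrite unpair-pair (code E (f zero)) (codeFun n (f ∘ suc)) = dec-code E (f zero)
  decFun-codeFun (suc n) f (suc j)
    rewrite unpair-pair (code E (f zero)) (codeFun n (f ∘ suc)) = decFun-codeFun n (f ∘ suc) j

  enumFinFun : ∀ n → EnumUpTo (Fin n → A) (λ f g → ∀ i → f i ~ g i)
  enumFinFun n = record { dec = decFun n ; code = codeFun n ; dec-code = decFun-codeFun n }

  enumSymFun : EnumUpTo (Sym → A) (λ f g → ∀ s → f s ~ g s)
  enumSymFun .dec e  = decFun 3 e ∘ fromSym
  enumSymFun .code f = codeFun 3 (f ∘ toSym)
  enumSymFun .dec-code f blank = decFun-codeFun 3 (f ∘ toSym) 0F
  enumSymFun .dec-code f b0    = decFun-codeFun 3 (f ∘ toSym) 1F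
  enumSymFun .dec-code f b1    = decFun-codeFun 3 (f ∘ toSym) 2F

  enumBoolFun : EnumUpTo (Bool → A) (λ f g → ∀ b → f b ~ g b)
  enumBoolFun .dec e false = decFun 2 e 0F
  enumBoolFun .dec e true  = decFun 2 e 1F
  enumBoolFun .code f = codeFun 2 (λ { 0F → f false ; 1F → f true })
  enumBoolFun .dec-code f false = decFun-codeFun 2 (λ { 0F → f false ; 1F → f true }) 0F
  enumBoolFun .dec-code f true  = decFun-codeFun 2 (λ { 0F → f false ; 1F → f true }) 1F

-- Machines up to a map of states, and their indices

record _≈_ (M M' : OTM) : Set where
  field
    -- A map of states that respects the data of both machines carries runs of `M` to runs of `M'`;
    -- it stands in for equality of machines, whose fields agree only pointwise.
    cast    : Fin (nQ M) → Fin (nQ M')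
    startEq : cast (start M) ≡ start M'
    kindEq  : ∀ q → kind M' (cast q) ≡ kind M q
    δEq     : ∀ q a b → δ M' (cast q) a b ≡ map (map₁ cast) (δ M q a b)
    ansEq   : ∀ q b → ans M' (cast q) b ≡ cast (ans M q b)

module _ (k : ℕ) where

  enumδ : EnumUpTo (Fin (suc k) → Sym → Sym → List (Fin (suc k) × Sym × Move × Sym × Move))
                   (λ f g → ∀ q a b → f q a b ≡ g q a b)
  enumδ = enumFinFun (enumSymFun (enumSymFun (enumList
            (enumProd (enumFin k) (enumProd enumSym (enumProd enumMove (enumProd enumSym enumMove))))))) (suc k)

  enumKinds : EnumUpTo (Fin (suc k) → Kind) (λ f g → ∀ q → f q ≡ g q)
  enumKinds = enumFinFun enumKind (suc k)

  enumAns : EnumUpTo (Fin (suc k) → Bool → Fin (suc k)) (λ f g → ∀ q b → f q b ≡ g q b)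
  enumAns = enumFinFun (enumBoolFun (enumFin k)) (suc k)

machFields : ℕ → ℕ → ℕ → ℕ → ℕ → OTM
machFields k s κ d a = record
  { nQ = suc k ; start = dec (enumFin k) s ; kind = dec (enumKinds k) κ
  ; δ = dec (enumδ k) d ; ans = dec (enumAns k) a }

abstract
  -- The second component of e is ignored, so that every machine has
  -- arbitrarily large indices.
  mach : ℕ → OTM
  mach e =
    let (f , _)  = unpair e
        (k , e₁) = unpair f
        (s , e₂) = unpair e₁
        (κ , e₃) = unpair e₂
        (d , a)  = unpair e₃
    in machFields k s κ d a

  machFields-eq : ∀ k s κ d a c →
    mach (pair (pair k (pair s (pair κ (pair d a)))) c) ≡ machFields k s κ d a
  machFields-eq k s κ d a c
    rewrite unpair-pair (pair k (pair s (pair κ (pair d a)))) c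
          | unpair-pair k (pair s (pair κ (pair d a)))
          | unpair-pair s (pair κ (pair d a)) | unpair-pair κ (pair d a) | unpair-pair d a = refl

-- The bound `c ≤ e` lets the clock of a simulation query, which grows with the index, exceed the
-- running time of a machine with time constant `c`.
mach-surjective : ∀ M c → ∃ λ e → c ≤ e × M ≈ mach e × mach e ≈ M
-- This case is exhaustive, as the start state shows that `nQ` is positive.
mach-surjective record { nQ = suc k ; start = s ; kind = κ ; δ = d ; ans = a } c =
  pair _ c , pair≥₂ _ c ,
  subst (M ≈_) (sym eq) record
    { cast = λ q → q ; startEq = sym (dec-code (enumFin k) s)
    ; kindEq = dec-code (enumKinds k) κ
    ; δEq = λ q x y → trans (dec-code (enumδ k) d q x y) (sym (map-id (d q x y)))
    ; ansEq = dec-code (enumAns k) a } ,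
  subst (_≈ M) (sym eq) record
    { cast = λ q → q ; startEq = dec-code (enumFin k) s
    ; kindEq = λ q → sym (dec-code (enumKinds k) κ q)
    ; δEq = λ q x y → trans (sym (dec-code (enumδ k) d q x y)) (sym (map-id _))
    ; ansEq = λ q b → sym (dec-code (enumAns k) a q b) }
  where
  M = record { nQ = suc k ; start = s ; kind = κ ; δ = d ; ans = a }
  eq = machFields-eq k (code (enumFin k) s) (code (enumKinds k) κ) (code (enumδ k) d) (code (enumAns k) a) c

-- Runs, certificates and deterministic evaluation

accept? : ∀ (k : Kind) → Dec (k ≡ accept)
accept? normal = no λ ()
accept? accept = yes refl
accept? reject = no λ ()
accept? query  = no λ ()

Oracle : Set
Oracle = Word → Bool

⌜_⌝ : Oracle → ℕ → Bool
⌜ W ⌝ n = W (encode n)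

singleton : ∀ {X : Set} {x : X} {xs} → length xs ≤ 1 → x ∈ xs → xs ≡ x ∷ []
singleton {xs = _ ∷ []} le (here refl) = refl
singleton {xs = _ ∷ _ ∷ _} (s≤s ()) m

module _ (M : OTM) where

  initW : Word → Config M
  initW w = config (start M) (initTape w) blankTape

  Accepting : Config M → Set
  Accepting c = kind M (Config.state c) ≡ accept

  apply : Tape → Tape → Fin (nQ M) × Sym × Move × Sym × Move → Config M
  apply w o (q , sw , mw , so , mo) = config q (move mw (write sw w)) (move mo (write so o))

  -- The kind is a separate argument, so that rewriting with an equation for it makes the list
  -- compute.
  succsOf : Kind → (ℕ → Bool) → Config M → List (Config M)
  succsOf normal A (config q w o) = map (apply w o) (δ M q (Tape.here w) (Tape.here o))
  succsOf query  A (config q w o) = config (ans M q (A (decode (queryWord o)))) w blankTape ∷ []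
  succsOf accept A c = []
  succsOf reject A c = []

  succs : (ℕ → Bool) → Config M → List (Config M)
  succs A c = succsOf (kind M (Config.state c)) A c

  module _ {A : ℕ → Bool} where

    Step⇒succs : ∀ {c c'} → Step M A c c' → c' ∈ succs A c
    Step⇒succs {config q w o} (normalStep k m) rewrite k = ∈-map⁺ (apply w o) m
    Step⇒succs (queryStep k)    rewrite k = here refl

    succs⇒Step : ∀ {c c'} → c' ∈ succs A c → Step M A c c'
    succs⇒Step {config q w o} m with kind M q in k
    ... | query with m
    ...   | here refl = queryStep k
    succs⇒Step {config q w o} m | normal with ∈-map⁻ (apply w o) m
    ... | _ , t , refl = normalStep k t

    stuck : ∀ {c} → Accepting c → succs A c ≡ []
    stuck k rewrite k = refl

  AccFrom : (ℕ → Bool) → ℕ → Config M → Set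
  AccFrom A T c = ∃ λ t → ∃ λ c' → t ≤ T × Steps M A t c c' × Accepting c'

  AccIn : (ℕ → Bool) → ℕ → Word → Set
  AccIn A T w = AccFrom A T (initW w)

  accFrom? : ∀ A T c → Dec (AccFrom A T c)
  accFrom? A T c with accept? (kind M (Config.state c))
  ... | yes k = yes (0 , c , z≤n , done , k)
  accFrom? A zero c | no k = no λ { (zero , _ , _ , done , k') → k k' }
  accFrom? A (suc T) c | no k = map′ to from (any? (accFrom? A T) (succs A c))
    where
    to : Any (AccFrom A T) (succs A c) → AccFrom A (suc T) c
    to p with find p
    ... | c' , m , t , c'' , le , ss , k' = suc t , c'' , s≤s le , step (succs⇒Step m) ss , k'
    from : AccFrom A (suc T) c → Any (AccFrom A T) (succs A c)
    from (zero , _ , _ , done , k') = ⊥-elim (k k')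
    from (suc t , c' , s≤s le , step s ss , k') = lose (Step⇒succs s) (t , c' , le , ss , k')

  accIn? : ∀ A T w → Dec (AccIn A T w)
  accIn? A T w = accFrom? A T (initW w)

  -- The machine decoded at a stage may be nondeterministic. Following the first successor gives
  -- every machine one clocked run, which for deterministic machines is the true one (`run-steps`).
  run : (ℕ → Bool) → ℕ → Config M → Config M
  runFrom : (ℕ → Bool) → ℕ → Config M → List (Config M) → Config M
  run A zero    c = c
  run A (suc T) c = runFrom A T c (succs A c)
  runFrom A T c []       = c
  runFrom A T c (c' ∷ _) = run A T c'

  run-accepting : ∀ A T {c} → Accepting c → run A T c ≡ c
  run-accepting A zero    k = refl
  run-accepting A (suc T) {c} k = cong (runFrom A T c) (stuck {A} {c} k)

  succs-deterministic : Deterministic M → ∀ A c → length (succs A c) ≤ 1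
  succs-deterministic det A (config q w o) with kind M q
  ... | normal = subst (_≤ 1) (sym (length-map _ (δ M q _ _))) (det q _ _)
  ... | query  = s≤s z≤n
  ... | accept = z≤n
  ... | reject = z≤n

  run-steps : Deterministic M → ∀ {A t T c c'} → Steps M A t c c' → Accepting c' → t ≤ T → run A T c ≡ c'
  run-steps det {A} {T = T} done k le = run-accepting A T k
  run-steps det {A} {c = c} (step s ss) k (s≤s le)
    = trans (cong (runFrom A _ c) (singleton (succs-deterministic det A c) (Step⇒succs s))) (run-steps det ss k le)

-- Tape sizes, queries and certificates

size : Tape → ℕ
size (tape l h r) = suc (length l + length r)

size-move : ∀ m t → size (move m t) ≤ suc (size t)
size-move L (tape [] h r)      = ≤-refl
size-move L (tape (x ∷ l) h r) = s≤s (≤-trans (≤-reflexive (+-suc (length l) (length r))) (n≤1+n _))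
size-move R (tape l h [])      = ≤-refl
size-move R (tape l h (x ∷ r)) = s≤s (s≤s (+-monoʳ-≤ (length l) (n≤1+n _)))
size-move S t                  = n≤1+n _

size-write : ∀ s t → size (write s t) ≡ size t
size-write s (tape l h r) = refl

bitsOf-length : ∀ s → length (bitsOf s) ≤ length s
bitsOf-length []          = z≤n
bitsOf-length (blank ∷ s) = m≤n⇒m≤1+n (bitsOf-length s)
bitsOf-length (b0 ∷ s)    = s≤s (bitsOf-length s)
bitsOf-length (b1 ∷ s)    = s≤s (bitsOf-length s)

readBits-length : ∀ s → length (readBits s) ≤ length s
readBits-length []          = z≤n
readBits-length (blank ∷ s) = z≤n
readBits-length (b0 ∷ s)    = s≤s (readBits-length s)
readBits-length (b1 ∷ s)    = s≤s (readBits-length s)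

queryWord-length : ∀ o → length (queryWord o) ≤ size o
queryWord-length (tape l h r) = ≤-trans (bitsOf-length (reverse l ++ h ∷ r)) (≤-reflexive (begin
    length (reverse l ++ h ∷ r)       ≡⟨ length-++ (reverse l) ⟩
    length (reverse l) + suc (length r) ≡⟨ cong (_+ suc (length r)) (length-reverse l) ⟩
    length l + suc (length r)         ≡⟨ +-suc (length l) (length r) ⟩
    suc (length l + length r)         ∎))
  where open ≡-Reasoning

output : ∀ {M} → Config M → Word
output c = readBits (Tape.here (Config.work c) ∷ Tape.right (Config.work c))

output-length : ∀ {M} (c : Config M) → length (output c) ≤ size (Config.work c)
output-length (config q (tape l h r) o) =
  ≤-trans (readBits-length (h ∷ r)) (s≤s (m≤n+m (length r) (length l)))

module _ (M : OTM) where

  queriesOf : Kind → Tape → List Word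
  queriesOf query o = queryWord o ∷ []
  queriesOf _     o = []

  queries : Config M → List Word
  queries c = queriesOf (kind M (Config.state c)) (Config.oracle c)

  succs-agree : ∀ {A B} (c : Config M) →
    All (λ q → A q ≡ B q) (queries c) →
    succs M ⌜ A ⌝ c ≡ succs M ⌜ B ⌝ c
  succs-agree (config q w o) ag with kind M q
  ... | normal = refl
  ... | accept = refl
  ... | reject = refl
  succs-agree (config q w o) (e ∷ []) | query
    rewrite encode-decode (queryWord o) | e = refl

  Small : ℕ → Config M → Set
  Small z c = 1 ≤ z × size (Config.oracle c) ≤ z

  succs-small : ∀ {A z c c'} → Small z c → c' ∈ succs M A c → Small (suc z) c'
  succs-small {c = config q w o} (1≤z , le) m with kind M q
  ... | query with m
  ...   | here refl = s≤s z≤n , s≤s z≤n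
  succs-small {c = config q w o} (1≤z , le) m | normal with ∈-map⁻ (apply M w o) m
  ... | (_ , _ , _ , so , mo) , _ , refl =
    s≤s z≤n , ≤-trans (size-move mo (write so o)) (s≤s (≤-trans (≤-reflexive (size-write so o)) le))

  queries-length : ∀ {z c} → Small z c →
    All (λ q → length q ≤ z) (queries c) ×
    length (queries c) ≤ 1
  queries-length {c = config q w o} (_ , le) with kind M q
  ... | query  = (≤-trans (queryWord-length o) le ∷ []) , s≤s z≤n
  ... | normal = [] , z≤n
  ... | accept = [] , z≤n
  ... | reject = [] , z≤n

-- A certificate in the sense of query complexity: the answers on `Q` alone guarantee `P`. A stage
-- preserves these answers, so both the number and the length of the queries matter.
Cert : ℕ → ℕ → Oracle → (Oracle → Set) → Set
Cert t z A P = ∃ λ Q → length Q ≤ t × All (λ q → length q < z) Q ×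
               (∀ B → All (λ q → A q ≡ B q) Q → P B)

bound-shift : ∀ {z t} {Q : List Word} → All (λ q → length q < suc z + t) Q → All (λ q → length q < z + suc t) Q
bound-shift {z} {t} = All.map (λ le → ≤-trans le (≤-reflexive (sym (+-suc z t))))

cert-local : ∀ {A B t z P} → (∀ q → length q < z → A q ≡ B q) → Cert t z A P → P B
cert-local ag (Q , _ , short , ok) = ok _ (All.map (ag _) short)

module _ (M : OTM) where

  -- Each step asks at most one query and lengthens the oracle tape by at most one cell. Preserving
  -- the answers along a path preserves the path, whatever other paths do.
  steps-cert : ∀ {A t z c c'} → Small M z c → Steps M ⌜ A ⌝ t c c' →
    Cert t (z + t) A (λ B → Steps M ⌜ B ⌝ t c c')
  steps-cert sm done = [] , z≤n , [] , λ _ _ → done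
  steps-cert {A} {suc t} {z} {c} sm (step s ss)
    with steps-cert (succs-small M sm (Step⇒succs M s)) ss | queries-length M {c = c} sm
  ... | Q , len , short , ok | short₀ , len₀ =
    queries M c ++ Q , ≤-trans (≤-reflexive (length-++ (queries M c) {Q})) (+-mono-≤ len₀ len) ,
    ++⁺ (All.map (λ le → ≤-<-trans le (m<m+n z (s≤s z≤n))) short₀) (bound-shift {z} {t} short) ,
    λ B ag → let ag₁ , ag₂ = ++⁻ (queries M c) ag in
      step (succs⇒Step M (subst (_ ∈_) (succs-agree M c ag₁) (Step⇒succs M s))) (ok B ag₂)

  run-cert : ∀ {A z} T c → Small M z c →
    Cert T (z + T) A (λ B → run M ⌜ B ⌝ T c ≡ run M ⌜ A ⌝ T c)
  run-cert zero c sm = [] , z≤n , [] , λ _ _ → refl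
  run-cert {A} {z} (suc T) c sm with succs M ⌜ A ⌝ c in eq | queries-length M {c = c} sm
  -- A stuck configuration has to remain stuck under the other oracle; its successors depend only on
  -- its own queries.
  ... | [] | short₀ , len₀ = queries M c , ≤-trans len₀ (s≤s z≤n) , All.map (λ le → ≤-<-trans le (m<m+n z (s≤s z≤n))) short₀ ,
    λ B ag → cong (runFrom M ⌜ B ⌝ T c) (trans (sym (succs-agree M c ag)) eq)
  ... | c' ∷ cs | short₀ , len₀
    with run-cert {A} T c' (succs-small M sm (subst (c' ∈_) (sym eq) (here refl)))
  ... | Q , len , short , ok =
    queries M c ++ Q , ≤-trans (≤-reflexive (length-++ (queries M c) {Q})) (+-mono-≤ len₀ len) ,
    ++⁺ (All.map (λ le → ≤-<-trans le (m<m+n z (s≤s z≤n))) short₀) (bound-shift {z} {T} short) ,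
    λ B ag → let ag₁ , ag₂ = ++⁻ (queries M c) ag in
      trans (cong (runFrom M ⌜ B ⌝ T c) (trans (sym (succs-agree M c ag₁)) eq)) (ok B ag₂)

  initW-small : ∀ w → Small M 1 (initW M w)
  initW-small w = s≤s z≤n , s≤s z≤n

  accIn-cert : ∀ {A T w} → AccIn M ⌜ A ⌝ T w → Cert T (suc T) A (λ B → AccIn M ⌜ B ⌝ T w)
  accIn-cert {A} {w = w} (t , c , le , ss , k) with steps-cert {A} (initW-small w) ss
  ... | Q , len , short , ok = Q , ≤-trans len le , All.map (λ lt → <-≤-trans lt (s≤s le)) short ,
    λ B ag → t , c , le , ok B ag , k

  accIn-local : ∀ {A B T w} → (∀ q → length q ≤ T → A q ≡ B q) → AccIn M ⌜ A ⌝ T w → AccIn M ⌜ B ⌝ T w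
  accIn-local {A} {B} {T} {w} ag acc =
    cert-local {A} {B} {T} {suc T} (λ { q (s≤s le) → ag q le }) (accIn-cert {A} acc)

  run-local : ∀ {A B} T w → (∀ q → length q ≤ T → A q ≡ B q) →
    run M ⌜ B ⌝ T (initW M w) ≡ run M ⌜ A ⌝ T (initW M w)
  run-local {A} {B} T w ag =
    cert-local {A} {B} {T} {suc T} (λ { q (s≤s le) → ag q le }) (run-cert {A} T (initW M w) (initW-small w))

  succs-work : ∀ {A c c'} → c' ∈ succs M A c → size (Config.work c') ≤ suc (size (Config.work c))
  succs-work {c = config q w o} m with kind M q
  ... | query with m
  ...   | here refl = n≤1+n _
  succs-work {c = config q w o} m | normal with ∈-map⁻ (apply M w o) m
  ... | (_ , sw , mw , _) , _ , refl =
    ≤-trans (size-move mw (write sw w)) (s≤s (≤-reflexive (size-write sw w)))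

  run-work : ∀ A T c → size (Config.work (run M A T c)) ≤ size (Config.work c) + T
  run-work A zero c = m≤m+n _ 0
  run-work A (suc T) c with succs M A c in eq
  ... | []      = m≤m+n _ _
  ... | c' ∷ cs = begin
    size (Config.work (run M A T c')) ≤⟨ run-work A T c' ⟩
    size (Config.work c') + T         ≤⟨ +-monoˡ-≤ T (succs-work {A} {c} (subst (c' ∈_) (sym eq) (here refl))) ⟩
    suc (size (Config.work c) + T)    ≡⟨ +-suc _ T ⟨
    size (Config.work c) + suc T      ∎
    where open ≤-Reasoning

  initTape-size : ∀ w → size (initTape w) ≤ suc (length w)
  initTape-size []      = ≤-refl
  initTape-size (b ∷ w) = s≤s (≤-trans (≤-reflexive (length-map bit w)) (n≤1+n _))

  run-output : ∀ A T w → length (output (run M A T (initW M w))) ≤ suc (length w) + T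
  run-output A T w = ≤-trans (output-length (run M A T (initW M w)))
    (≤-trans (run-work A T (initW M w)) (+-monoˡ-≤ T (initTape-size w)))

-- Time bounds, transport of runs and forced segments

module _ {M : OTM} {A : ℕ → Bool} where

  truncate : ∀ {t t' c c'} → t' ≤ t → Steps M A t c c' → ∃ λ c'' → Steps M A t' c c''
  truncate z≤n      ss          = _ , done
  truncate (s≤s le) (step s ss) with truncate le ss
  ... | c'' , ss' = c'' , step s ss'

  -- `TimeBound` excludes runs of exactly one step too many; any longer run has such a prefix.
  timeBound-steps : ∀ T n {t c} → TimeBound M A T → Steps M A t (init M n) c → t ≤ T ∣ n ∣
  timeBound-steps T n {t} tb ss with t ≤? T ∣ n ∣
  ... | yes le = le
  ... | no nle = ⊥-elim (tb n _ (proj₂ (truncate (≰⇒> nle) ss)))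

  accepts⇒accIn : ∀ T n → TimeBound M A T → Accepts M A n → AccIn M A (T ∣ n ∣) (encode n)
  accepts⇒accIn T n tb (t , c , ss , k) = t , c , timeBound-steps T n tb ss , ss , k

  accIn⇒accepts : ∀ T n → AccIn M A T (encode n) → Accepts M A n
  accIn⇒accepts T n (t , c , _ , ss , k) = t , c , ss , k

module _ {M M' : OTM} (eq : M ≈ M') {A : ℕ → Bool} where
  open _≈_ eq

  castConfig : Config M → Config M'
  castConfig (config q w o) = config (cast q) w o

  cast-step : ∀ {c c'} → Step M A c c' → Step M' A (castConfig c) (castConfig c')
  cast-step (normalStep {q} {w} {o} k m) =
    normalStep (trans (kindEq q) k) (subst (_ ∈_) (sym (δEq q _ _)) (∈-map⁺ (map₁ cast) m))
  cast-step (queryStep {q} {w} {o} k) =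
    subst (λ p → Step M' A (config (cast q) w o) (config p w blankTape)) (ansEq q _)
      (queryStep {q = cast q} {w} {o} (trans (kindEq q) k))

  cast-steps : ∀ {t c c'} → Steps M A t c c' → Steps M' A t (castConfig c) (castConfig c')
  cast-steps done        = done
  cast-steps (step s ss) = step (cast-step s) (cast-steps ss)

  cast-init : ∀ n → castConfig (init M n) ≡ init M' n
  cast-init n = cong (λ q → config q _ _) startEq

  cast-initSteps : ∀ n {t c} → Steps M A t (init M n) c → Steps M' A t (init M' n) (castConfig c)
  cast-initSteps n {t} {c} ss = subst (λ i → Steps M' A t i (castConfig c)) (cast-init n) (cast-steps ss)

  cast-accepts : ∀ n → Accepts M A n → Accepts M' A n
  cast-accepts n (t , c , ss , k) = t , castConfig c , cast-initSteps n ss , trans (kindEq _) k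

  cast-timeBound : ∀ {T} → TimeBound M' A T → TimeBound M A T
  cast-timeBound tb n c ss = tb n _ (cast-initSteps n ss)

  cast-deterministic : Deterministic M' → Deterministic M
  cast-deterministic det q a b =
    subst (_≤ 1) (trans (cong length (δEq q a b)) (length-map _ (δ M q a b))) (det (cast q) a b)

module _ (M : OTM) (A : ℕ → Bool) where

  Bounded : ℕ → Config M → Set
  Bounded T c = ∀ t c' → Steps M A t c c' → t ≤ T

  AccEv : Config M → Set
  AccEv c = ∃ λ t → ∃ λ c' → Steps M A t c c' × Accepting M c'

  bounded-step : ∀ {T c} → (∀ c' → c' ∈ succs M A c → Bounded T c') → Bounded (suc T) c
  bounded-step f zero    c' done        = z≤n
  bounded-step f (suc t) c' (step s ss) = s≤s (f _ (Step⇒succs M s) t c' ss)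

  bounded-stuck : ∀ {T c} → succs M A c ≡ [] → Bounded T c
  bounded-stuck eq zero    c' done        = z≤n
  bounded-stuck eq (suc t) c' (step s ss) with () ← subst (_ ∈_) eq (Step⇒succs M s)

  accEv-step : ∀ {c c'} → c' ∈ succs M A c → AccEv c' → AccEv c
  accEv-step m (t , c'' , ss , k) = suc t , c'' , step (succs⇒Step M m) ss , k

  accEv-unstep : ∀ {c} → ¬ Accepting M c → AccEv c → ∃ λ c' → c' ∈ succs M A c × AccEv c'
  accEv-unstep na (zero , _ , done , k) = ⊥-elim (na k)
  accEv-unstep na (suc t , c'' , step s ss , k) = _ , Step⇒succs M s , t , c'' , ss , k

  infix 4 _⟶[_]_
  -- Every configuration left on such a segment has a single successor, so acceptance passes along
  -- the segment in both directions, and a time bound passes from its end to its start.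
  data _⟶[_]_ : Config M → ℕ → Config M → Set where
    stop : ∀ {c} → c ⟶[ 0 ] c
    then : ∀ {t c c' c''} → succs M A c ≡ c' ∷ [] → c' ⟶[ t ] c'' → c ⟶[ suc t ] c''

  _⨾_ : ∀ {s t c c' c''} → c ⟶[ s ] c' → c' ⟶[ t ] c'' → c ⟶[ s + t ] c''
  stop      ⨾ q = q
  then eq p ⨾ q = then eq (p ⨾ q)

  land : ∀ {t c c' c''} → c ⟶[ t ] c' → c' ≡ c'' → c ⟶[ t ] c''
  land p refl = p

  ⟶-bounded : ∀ {t T c c'} → c ⟶[ t ] c' → Bounded T c' → Bounded (t + T) c
  ⟶-bounded stop b = b
  ⟶-bounded {c = c} (then eq p) b = bounded-step λ { c'' m → lem c'' (subst (c'' ∈_) eq m) }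
    where
    lem : ∀ c'' → c'' ∈ _ ∷ [] → Bounded _ c''
    lem c'' (here refl) = ⟶-bounded p b

  ⟶-accEv : ∀ {t c c'} → c ⟶[ t ] c' → AccEv c' → AccEv c
  ⟶-accEv stop a = a
  ⟶-accEv (then eq p) a = accEv-step (subst (_ ∈_) (sym eq) (here refl)) (⟶-accEv p a)

  ⟶-unaccEv : ∀ {t c c'} → c ⟶[ t ] c' → AccEv c → AccEv c'
  ⟶-unaccEv stop a = a
  ⟶-unaccEv {c = c} (then eq p) a with accEv-unstep {c} na a
    where
    na : ¬ Accepting M c
    na k with () ← trans (sym eq) (stuck M k)
  ... | c'' , m , a' with subst (c'' ∈_) eq m
  ... | here refl = ⟶-unaccEv p a'

-- The oracle with a given free part

_≟ʷ_ : (u v : Word) → Dec (u ≡ v)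
_≟ʷ_ = ≡-dec Bool._≟_

bitℕ : Bool → ℕ
bitℕ false = 0
bitℕ true  = 1

simTail : ℕ → Word → ℕ → Word
simTail e []      t = ones t []
simTail e (b ∷ w) t = ones (bitℕ b + suc e) (false ∷ simTail e w t)

-- The query "does machine e accept w within t steps?".  Repeating 1^e in
-- every block makes the part before 1^t longer than e * length w.
simWord : ℕ → Word → ℕ → Word
simWord e w t = ones (suc e) (false ∷ simTail e w t)

-- A block of `suc e` ones stands for `false` and one more for `true`. The last block is the clock
-- and not a bit.
parseBits : ℕ → List ℕ → Word
parseBits e (a ∷ r@(_ ∷ _)) = (suc e <ᵇ a) ∷ parseBits e r
parseBits e _               = []

parseLast : List ℕ → ℕ
parseLast []              = 0
parseLast (a ∷ [])        = a
parseLast (a ∷ r@(_ ∷ _)) = parseLast r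

parse : List ℕ → ℕ × Word × ℕ
parse (suc e ∷ r) = e , parseBits e r , parseLast r
-- A harmless default: `Admissible` encodes the result again and compares it with the word.
parse _           = 0 , [] , 0

<ᵇ-irrefl : ∀ n → (n <ᵇ n) ≡ false
<ᵇ-irrefl zero    = refl
<ᵇ-irrefl (suc n) = <ᵇ-irrefl n

<ᵇ-suc : ∀ n → (n <ᵇ suc n) ≡ true
<ᵇ-suc zero    = refl
<ᵇ-suc (suc n) = <ᵇ-suc n

parse-tail : ∀ e w t → ∃ λ a → ∃ λ r → split (simTail e w t) ≡ a ∷ r ×
             parseBits e (a ∷ r) ≡ w × parseLast (a ∷ r) ≡ t
parse-tail e [] t = t , [] , split-ones t , refl , refl
parse-tail e (b ∷ w) t with parse-tail e w t
... | a , r , eq , pb , pl = bitℕ b + suc e , a ∷ r ,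
      trans (split-block (bitℕ b + suc e) _) (cong (_ ∷_) eq) , cong₂ _∷_ (lem b) pb , pl
  where
  lem : ∀ b → (suc e <ᵇ bitℕ b + suc e) ≡ b
  lem false = <ᵇ-irrefl e
  lem true  = <ᵇ-suc e

parse-simWord : ∀ e w t → parse (split (simWord e w t)) ≡ (e , w , t)
parse-simWord e w t with parse-tail e w t
... | a , r , eq , pb , pl
  rewrite split-block e (simTail e w t) | eq | pb | pl = refl

simTail-length : ∀ e w t → length w * suc e + t ≤ length (simTail e w t)
simTail-length e [] t rewrite length-ones t [] = m≤m+n t 0
simTail-length e (b ∷ w) t rewrite length-ones (bitℕ b + suc e) (false ∷ simTail e w t)
  | +-assoc (suc e) (length w * suc e) t =
  +-mono-≤ (m≤n+m (suc e) (bitℕ b)) (m≤n⇒m≤1+n (simTail-length e w t))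

simWord-length : ∀ e w t → suc (length w) * suc e + t < length (simWord e w t)
simWord-length e w t rewrite length-ones e (false ∷ simTail e w t)
  | +-assoc (suc e) (length w * suc e) t | +-suc e (length (simTail e w t)) =
  s≤s (s≤s (+-monoʳ-≤ e (simTail-length e w t)))

simWord-pad : ∀ e w t → t < length (simWord e w t)
simWord-pad e w t = ≤-<-trans (m≤n+m t _) (simWord-length e w t)

simWord-index : ∀ e w t → e ≤ length (simWord e w t)
simWord-index e w t rewrite length-ones e (false ∷ simTail e w t) = m≤n⇒m≤1+n (m≤m+n e _)

Admissible : Word → ℕ × Word × ℕ → Set
Admissible u (e , w , t) = simWord e w t ≡ u × decode w ≤ length u

admissible? : ∀ u p → Dec (Admissible u p)
admissible? u (e , w , t) = (simWord e w t ≟ʷ u) ×-dec (decode w ≤? length u)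

sim : Word → Maybe (ℕ × Word × ℕ)
sim u with admissible? u (parse (split u))
... | yes _ = just (parse (split u))
... | no  _ = nothing

sim-sound : ∀ u {p} → sim u ≡ just p → Admissible u p
sim-sound u eq with admissible? u (parse (split u))
sim-sound u refl | yes ad = ad

sim-complete : ∀ e w t → decode w ≤ length (simWord e w t) → sim (simWord e w t) ≡ just (e , w , t)
sim-complete e w t le with admissible? (simWord e w t) (parse (split (simWord e w t)))
... | yes _ = cong just (parse-simWord e w t)
... | no na = ⊥-elim (na (subst (Admissible _) (sym (parse-simWord e w t)) (refl , le)))

-- Simulation words begin with a one.
sim-free : ∀ u → sim (false ∷ u) ≡ nothing
sim-free u with admissible? (false ∷ u) (parse (split (false ∷ u)))
... | no _ = refl

value : Oracle → Oracle → Word → Maybe (ℕ × Word × ℕ) → Bool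
value O W u nothing            = O u
value O W u (just (e , w , t)) = does (accIn? (mach e) ⌜ W ⌝ t w)

-- A simulation query of length l concerns computations of fewer than l steps,
-- hence only shorter queries; so the length of u is enough fuel (see V-eq).
VFuel : ℕ → Oracle → Oracle
VFuel zero    O u = O u
VFuel (suc f) O u = value O (VFuel f O) u (sim u)

-- A computation of `t` steps asks queries of length at most `t`, and the simulation word contains
-- `t` in unary, hence is longer.
value-agree : ∀ {O O' W W'} u → O u ≡ O' u → (∀ q → length q < length u → W q ≡ W' q) →
  value O W u (sim u) ≡ value O' W' u (sim u)
value-agree {O} {O'} {W} {W'} u eq ag with sim u in s
... | nothing = eq
... | just (e , w , t) with sim-sound u s
... | refl , _ = does-⇔ (mk⇔ (accIn-local (mach e) ag') (accIn-local (mach e) (λ q le → sym (ag' q le))))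
                        (accIn? (mach e) ⌜ W ⌝ t w) (accIn? (mach e) ⌜ W' ⌝ t w)
  where
  ag' : ∀ q → length q ≤ t → W q ≡ W' q
  ag' q le = ag q (≤-<-trans le (simWord-pad e w t))

-- One induction gives both independence of the fuel (for `V-eq`) and locality in the free part (for
-- `V-local`).
VFuel-agree : ∀ {O O'} f f' u → (∀ q → length q ≤ length u → O q ≡ O' q) →
  length u < f → length u < f' → VFuel f O u ≡ VFuel f' O' u
VFuel-agree (suc f) (suc f') u ag (s≤s lt) (s≤s lt') = value-agree u (ag u ≤-refl) λ q lq →
  VFuel-agree f f' q (λ p lp → ag p (≤-trans lp (<⇒≤ lq))) (<-≤-trans lq lt) (<-≤-trans lq lt')

abstract
  V : Oracle → Oracle
  V O u = VFuel (suc (length u)) O u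

  V-eq : ∀ O u → V O u ≡ value O (V O) u (sim u)
  V-eq O u = value-agree u refl λ q lt → VFuel-agree _ _ q (λ _ _ → refl) lt ≤-refl

  V-local : ∀ {O O'} l → (∀ q → length q ≤ l → O q ≡ O' q) → ∀ u → length u ≤ l → V O u ≡ V O' u
  V-local l ag u le = VFuel-agree _ _ u (λ q lq → ag q (≤-trans lq le)) ≤-refl ≤-refl

V-sim : ∀ O e w t → decode w ≤ length (simWord e w t) →
  V O (simWord e w t) ≡ does (accIn? (mach e) ⌜ V O ⌝ t w)
V-sim O e w t le = trans (V-eq O (simWord e w t)) (cong (value O (V O) _) (sim-complete e w t le))

V-free : ∀ O u → V O (false ∷ u) ≡ O (false ∷ u)
V-free O u = trans (V-eq O (false ∷ u)) (cong (value O (V O) (false ∷ u)) (sim-free u))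

-- Free words and the choice of fresh words

inter : Word → Word → Word
inter (b ∷ v) (c ∷ y) = b ∷ c ∷ inter v y
inter _       _       = []

evens odds : Word → Word
evens (b ∷ _ ∷ z) = b ∷ evens z
evens _           = []
odds  (_ ∷ c ∷ z) = c ∷ odds z
odds  _           = []

evens-inter : ∀ v y → length y ≡ length v → evens (inter v y) ≡ v
evens-inter []      []      eq = refl
evens-inter (b ∷ v) (c ∷ y) eq = cong (b ∷_) (evens-inter v y (suc-injective eq))

odds-inter : ∀ v y → length y ≡ length v → odds (inter v y) ≡ y
odds-inter []      []      eq = refl
odds-inter (b ∷ v) (c ∷ y) eq = cong (c ∷_) (odds-inter v y (suc-injective eq))

-- The bit at position `y` on side `i` of the block of `v`. Interleaving allows a machine to write
-- this query in one pass over `v` while guessing `y`.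
freeWord : Bool → Word → Word → Word
freeWord i v y = false ∷ i ∷ inter v y

length-inter : ∀ v y → length y ≡ length v → length (inter v y) ≡ length v + length v
length-inter []      []      eq = refl
length-inter (b ∷ v) (c ∷ y) eq
  rewrite length-inter v y (suc-injective eq) = cong suc (sym (+-suc _ _))

tails : Bool → List Word → List Word
tails b []                = []
tails b ([] ∷ ws)          = tails b ws
tails b ((b' ∷ w) ∷ ws) with b Bool.≟ b'
... | yes _ = w ∷ tails b ws
... | no  _ = tails b ws

tails-∈ : ∀ b w ws → b ∷ w ∈ ws → w ∈ tails b ws
tails-∈ b w ([] ∷ ws) (there m) = tails-∈ b w ws m
tails-∈ b w ((b' ∷ u) ∷ ws) m with b Bool.≟ b' | m
... | yes _ | here refl = here refl
... | yes _ | there m'  = there (tails-∈ b w ws m')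
... | no n  | here refl = ⊥-elim (n refl)
... | no _  | there m'  = tails-∈ b w ws m'

tails-length : ∀ ws → length (tails false ws) + length (tails true ws) ≤ length ws
tails-length []                = z≤n
tails-length ([] ∷ ws)          = m≤n⇒m≤1+n (tails-length ws)
tails-length ((false ∷ w) ∷ ws) = s≤s (tails-length ws)
tails-length ((true  ∷ w) ∷ ws) = ≤-trans (≤-reflexive (+-suc _ _)) (s≤s (tails-length ws))

-- Pigeonhole by bisection: for one choice of the first letter, fewer than half of the possible
-- tails are excluded.
fresh : ∀ m (ws : List Word) → length ws < 2 ^ m → ∃ λ y → length y ≡ m × y ∉ ws
fresh zero    []      lt = [] , refl , λ ()
fresh zero    (_ ∷ ws) (s≤s ())
fresh (suc m) ws lt with length (tails false ws) <? 2 ^ m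
... | yes l with fresh m (tails false ws) l
...   | y , len , y∉ = false ∷ y , cong suc len , λ m → y∉ (tails-∈ false y ws m)
fresh (suc m) ws lt | no nl with fresh m (tails true ws) (+-cancelˡ-< (2 ^ m) _ _ (begin-strict
    2 ^ m + length (tails true ws)                  ≤⟨ +-monoˡ-≤ _ (≮⇒≥ nl) ⟩
    length (tails false ws) + length (tails true ws) ≤⟨ tails-length ws ⟩
    length ws                                       <⟨ lt ⟩
    2 ^ m + (2 ^ m + 0)                            ≡⟨ cong (2 ^ m +_) (+-identityʳ _) ⟩
    2 ^ m + 2 ^ m                                  ∎))
  where open ≤-Reasoning
... | y , len , y∉ = true ∷ y , cong suc len , λ m → y∉ (tails-∈ true y ws m)

-- NE is contained in E

at : List Sym → List Sym → Tape
at l []      = tape l blank []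
at l (x ∷ r) = tape l x r

move-R : ∀ l x r → move R (tape l x r) ≡ at (x ∷ l) r
move-R l x []      = refl
move-R l x (y ∷ r) = refl

initTape-at : ∀ w → initTape w ≡ at [] (map bit w)
initTape-at []      = refl
initTape-at (b ∷ w) = refl

syms : Sym → ℕ → List Sym → List Sym
syms s zero    l = l
syms s (suc k) l = s ∷ syms s k l

syms-snoc : ∀ s k l → syms s k (s ∷ l) ≡ s ∷ syms s k l
syms-snoc s zero    l = refl
syms-snoc s (suc k) l = cong (s ∷_) (syms-snoc s k l)

syms-+ : ∀ s j k l → syms s j (syms s k l) ≡ syms s (j + k) l
syms-+ s zero    k l = refl
syms-+ s (suc j) k l = cong (s ∷_) (syms-+ s j k l)

syms-ʳ++ : ∀ s k l z → syms s k l ʳ++ z ≡ l ʳ++ syms s k z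
syms-ʳ++ s zero    l z = refl
syms-ʳ++ s (suc k) l z = trans (syms-ʳ++ s k l (s ∷ z)) (cong (l ʳ++_) (syms-snoc s k z))

ones-snoc : ∀ k w → ones k (true ∷ w) ≡ true ∷ ones k w
ones-snoc zero    w = refl
ones-snoc (suc k) w = cong (true ∷_) (ones-snoc k w)

ones-ʳ++ : ∀ k w z → ones k w ʳ++ z ≡ w ʳ++ ones k z
ones-ʳ++ zero    w z = refl
ones-ʳ++ (suc k) w z = trans (ones-ʳ++ k w (true ∷ z)) (cong (w ʳ++_) (ones-snoc k z))

bitsOf-bits : ∀ u z → bitsOf (map bit u ++ z) ≡ u ++ bitsOf z
bitsOf-bits []          z = refl
bitsOf-bits (false ∷ u) z = cong (false ∷_) (bitsOf-bits u z)
bitsOf-bits (true  ∷ u) z = cong (true ∷_) (bitsOf-bits u z)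

bitsOf-ones : ∀ k z → bitsOf (syms b1 k z) ≡ ones k (bitsOf z)
bitsOf-ones zero    z = refl
bitsOf-ones (suc k) z = cong (true ∷_) (bitsOf-ones k z)

queryWord-left : ∀ l → queryWord (tape l blank []) ≡ bitsOf (l ʳ++ blank ∷ [])
queryWord-left l = cong bitsOf (sym (ʳ++-defn l))

map-bit-ʳ++ : ∀ w z → map bit w ʳ++ z ≡ map bit (reverse w) ++ z
map-bit-ʳ++ w z = trans (ʳ++-defn (map bit w)) (cong (_++ z) (sym (reverse-map bit w)))

-- The counter of sD and sK runs through all 2^k contents of a block of k
-- cells; countSteps k is the number of steps this takes.
countSteps : ℕ → ℕ
countSteps zero    = 0
countSteps (suc k) = countSteps k + suc (suc k + (countSteps k + 1))

countSteps-≥ : ∀ k → 2 ^ k ≤ suc (countSteps k)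
countSteps-≥ zero    = ≤-refl
countSteps-≥ (suc k) = begin
  2 * 2 ^ k                                     ≤⟨ *-monoʳ-≤ 2 (countSteps-≥ k) ⟩
  2 * suc c                                     ≡⟨ solve 1 (λ c → con 2 :* (con 1 :+ c) := c :+ (con 1 :+ (c :+ con 1))) refl c ⟩
  c + suc (c + 1)                               ≤⟨ +-monoʳ-≤ c (s≤s (m≤n+m (c + 1) (suc k))) ⟩
  countSteps (suc k)                            ≤⟨ n≤1+n _ ⟩
  suc (countSteps (suc k))                      ∎
  where
  c = countSteps k
  open ≤-Reasoning
  open +-*-Solver

countSteps-≤ : ∀ k → countSteps k + k + 4 ≤ 4 * 2 ^ k
countSteps-≤ zero    = ≤-refl
countSteps-≤ (suc k) = begin
  countSteps (suc k) + suc k + 4 ≡⟨ solve 2 (λ c k → c :+ (con 1 :+ (con 1 :+ k :+ (c :+ con 1))) :+ (con 1 :+ k) :+ con 4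
                                                  := con 2 :* (c :+ k :+ con 4)) refl c k ⟩
  2 * (c + k + 4)                ≤⟨ *-monoʳ-≤ 2 (countSteps-≤ k) ⟩
  2 * (4 * 2 ^ k)                ≡⟨ solve 1 (λ p → con 2 :* (con 4 :* p) := con 4 :* (con 2 :* p)) refl (2 ^ k) ⟩
  4 * (2 * 2 ^ k)                ∎
  where
  c = countSteps k
  open ≤-Reasoning
  open +-*-Solver

pattern rd = zero
pattern sB = suc zero
pattern sC = suc (suc zero)
pattern sD = suc (suc (suc zero))
pattern sK = suc (suc (suc (suc zero)))
pattern sQ = suc (suc (suc (suc (suc zero))))
pattern sA = suc (suc (suc (suc (suc (suc zero)))))
pattern sR = suc (suc (suc (suc (suc (suc (suc zero))))))
pattern ch i = suc (suc (suc (suc (suc (suc (suc (suc i)))))))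

module Simulator (e : ℕ) where

  Q : Set
  Q = Fin (10 + e)

  top : Q
  top = ch (fromℕ (suc e))

  kindD : Q → Kind
  kindD sQ = query
  kindD sA = accept
  kindD sR = reject
  kindD _  = normal

  -- ch writes 1^(e+1) 0 on the oracle tape and rd the input bits in between;
  -- sB, sC copy the length of the oracle word to a block of zeros on the work
  -- tape; sD, sK increment that block as a binary number until it overflows,
  -- writing a one on the oracle tape at every step.
  δD : Q → Sym → Sym → List (Q × Sym × Move × Sym × Move)
  δD rd blank o = (sB , blank , R , o , L) ∷ []
  δD rd b0 o    = (top , b0 , R , o , S) ∷ []
  δD rd b1 o    = (top , b1 , R , b1 , R) ∷ []
  δD sB w blank = (sC , w , L , blank , R) ∷ []
  δD sB w b0    = (sB , b0 , R , b0 , L) ∷ []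
  δD sB w b1    = (sB , b0 , R , b1 , L) ∷ []
  δD sC w blank = (sD , w , R , blank , S) ∷ []
  δD sC w b0    = (sC , w , L , b0 , R) ∷ []
  δD sC w b1    = (sC , w , L , b1 , R) ∷ []
  δD sD blank o = (sQ , blank , S , o , S) ∷ []
  δD sD b0 o    = (sK , b1 , L , b1 , R) ∷ []
  δD sD b1 o    = (sD , b0 , R , b1 , R) ∷ []
  δD sK blank o = (sD , blank , R , b1 , R) ∷ []
  δD sK b0 o    = (sK , b0 , L , b1 , R) ∷ []
  δD sK b1 o    = (sK , b1 , L , b1 , R) ∷ []
  δD sQ _ _     = []
  δD sA _ _     = []
  δD sR _ _     = []
  δD (ch zero) w o    = (rd , w , S , b0 , R) ∷ []
  δD (ch (suc i)) w o = (ch (inject₁ i) , w , S , b1 , R) ∷ []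

  D : OTM
  D = record { nQ = 10 + e ; start = top ; kind = kindD ; δ = δD
             ; ans = λ { _ true → sA ; _ false → sR } }

  D-deterministic : Deterministic D
  D-deterministic rd blank o = ≤-refl
  D-deterministic rd b0 o    = ≤-refl
  D-deterministic rd b1 o    = ≤-refl
  D-deterministic sB w blank = ≤-refl
  D-deterministic sB w b0    = ≤-refl
  D-deterministic sB w b1    = ≤-refl
  D-deterministic sC w blank = ≤-refl
  D-deterministic sC w b0    = ≤-refl
  D-deterministic sC w b1    = ≤-refl
  D-deterministic sD blank o = ≤-refl
  D-deterministic sD b0 o    = ≤-refl
  D-deterministic sD b1 o    = ≤-refl
  D-deterministic sK blank o = ≤-refl
  D-deterministic sK b0 o    = ≤-refl
  D-deterministic sK b1 o    = ≤-refl
  D-deterministic sQ _ _     = z≤n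
  D-deterministic sA _ _     = z≤n
  D-deterministic sR _ _     = z≤n
  D-deterministic (ch zero) w o    = ≤-refl
  D-deterministic (ch (suc i)) w o = ≤-refl

  module Run (A : ℕ → Bool) where

    infix 4 _⟹[_]_
    _⟹[_]_ : Config D → ℕ → Config D → Set
    _⟹[_]_ = _⟶[_]_ D A

    infixr 5 _⨟_
    _⨟_ : ∀ {s t c c' c''} → c ⟹[ s ] c' → c' ⟹[ t ] c'' → c ⟹[ s + t ] c''
    _⨟_ = _⨾_ D A

    one : ∀ {c c'} → succs D A c ≡ c' ∷ [] → c ⟹[ 1 ] c'
    one eq = then eq stop

    infixl 4 _▹_
    _▹_ : ∀ {t c c' c''} → c ⟹[ t ] c' → c' ≡ c'' → c ⟹[ t ] c''
    _▹_ = land D A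

    -- The cells to the left of the head are listed nearest first, so `u` is the written word in
    -- reverse; `_ʳ++_` turns it round.
    onTape : Word → Tape
    onTape u = tape (map bit u) blank []

    header : ∀ j i w u → toℕ i ≡ j →
      config (ch i) w (onTape u) ⟹[ suc j ] config rd w (onTape (false ∷ ones j u))
    header zero    zero    w u eq = one refl
    header (suc j) (suc i) w u eq =
      then refl (header j (inject₁ i) w (true ∷ u) (trans (toℕ-inject₁ i) (suc-injective eq)))
        ▹ cong (λ z → config rd w (onTape (false ∷ z))) (ones-snoc j u)

    pushBit : Bool → Word → Word
    pushBit false u = u
    pushBit true  u = true ∷ u

    blocks : Word → Word → Word
    blocks []      u = u
    blocks (b ∷ w) u = blocks w (false ∷ ones (suc e) (pushBit b u))

    copy : ∀ w l u → ∃ λ l' →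
      config rd (at l (map bit w)) (onTape u) ⟹[ length w * (3 + e) ] config rd (at l' []) (onTape (blocks w u))
    copy [] l u = l , stop
    copy (b ∷ w) l u with copy w (bit b ∷ l) (false ∷ ones (suc e) (pushBit b u))
    ... | l' , run = l' , read b ⨟ header (suc e) (fromℕ (suc e)) _ _ (toℕ-fromℕ (suc e)) ⨟ run
      where
      read : ∀ b → config rd (at l (bit b ∷ map bit w)) (onTape u)
                   ⟹[ 1 ] config top (at (bit b ∷ l) (map bit w)) (onTape (pushBit b u))
      read false = one (cong (λ t → config top t (onTape u) ∷ []) (move-R l b0 (map bit w)))
      read true  = one (cong (λ t → config top t (onTape (true ∷ u)) ∷ []) (move-R l b1 (map bit w)))

    blocks-ʳ++ : ∀ w u t → blocks w u ʳ++ ones t [] ≡ u ʳ++ simTail e w t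
    blocks-ʳ++ [] u t = refl
    blocks-ʳ++ (b ∷ w) u t = begin
      blocks w (false ∷ ones (suc e) (pushBit b u)) ʳ++ ones t []     ≡⟨ blocks-ʳ++ w _ t ⟩
      (false ∷ ones (suc e) (pushBit b u)) ʳ++ simTail e w t          ≡⟨ ones-ʳ++ (suc e) (pushBit b u) (false ∷ simTail e w t) ⟩
      pushBit b u ʳ++ ones (suc e) (false ∷ simTail e w t)            ≡⟨ push b ⟩
      u ʳ++ ones (bitℕ b + suc e) (false ∷ simTail e w t)             ∎
      where
      open ≡-Reasoning
      push : ∀ b → pushBit b u ʳ++ ones (suc e) (false ∷ simTail e w t)
                   ≡ u ʳ++ ones (bitℕ b + suc e) (false ∷ simTail e w t)
      push false = refl
      push true  = refl

    blocks-length : ∀ v u → length v * suc e + length u ≤ length (blocks v u) ×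
                            length (blocks v u) ≤ length v * (3 + e) + length u
    blocks-length [] u = ≤-refl , ≤-refl
    blocks-length (b ∷ v) u with blocks-length v (false ∷ ones (suc e) (pushBit b u))
    ... | lo , hi rewrite length-ones e (pushBit b u) =
      (begin
        suc e + length v * suc e + length u
          ≡⟨ solve 3 (λ e v u → con 1 :+ e :+ v :+ u := v :+ (con 1 :+ e :+ u)) refl e (length v * suc e) (length u) ⟩
        length v * suc e + (suc e + length u)
          ≤⟨ +-monoʳ-≤ (length v * suc e) (m≤n⇒m≤1+n (+-monoʳ-≤ (suc e) (push≥ b))) ⟩
        length v * suc e + (2 + (e + length (pushBit b u))) ≤⟨ lo ⟩
        length (blocks v (false ∷ ones (suc e) (pushBit b u))) ∎) ,
      (begin
        length (blocks v (false ∷ ones (suc e) (pushBit b u))) ≤⟨ hi ⟩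
        length v * (3 + e) + (2 + (e + length (pushBit b u)))
          ≤⟨ +-monoʳ-≤ (length v * (3 + e)) (+-monoʳ-≤ (2 + e) (push≤ b)) ⟩
        length v * (3 + e) + (2 + (e + suc (length u)))
          ≡⟨ solve 3 (λ e v u → v :+ (con 2 :+ (e :+ (con 1 :+ u))) := con 3 :+ e :+ v :+ u) refl e (length v * (3 + e)) (length u) ⟩
        3 + e + length v * (3 + e) + length u ∎)
      where
      push≥ : ∀ b → length u ≤ length (pushBit b u)
      push≥ false = ≤-refl
      push≥ true  = n≤1+n _
      push≤ : ∀ b → length (pushBit b u) ≤ suc (length u)
      push≤ false = n≤1+n _
      push≤ true  = ≤-refl
      open ≤-Reasoning
      open +-*-Solver

    -- The head passes leftwards over the oracle word and leaves one zero on the work tape for each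
    -- cell. Writing the oracle tape as a pending `move L` treats the empty and the nonempty rest
    -- alike.
    measure : ∀ u l x r →
      config sB (tape l blank []) (move L (tape (map bit u) x r)) ⟹[ length u ]
      config sB (tape (syms b0 (length u) l) blank []) (tape [] blank (map bit u ʳ++ x ∷ r))
    measure []      l x r = stop
    measure (b ∷ u) l x r =
      then (go b) (measure u (b0 ∷ l) (bit b) (x ∷ r))
        ▹ cong (λ z → config sB (tape z blank []) _) (syms-snoc b0 (length u) l)
      where
      go : ∀ b → succs D A (config sB (tape l blank []) (tape (map bit u) (bit b) (x ∷ r)))
                 ≡ config sB (tape (b0 ∷ l) blank []) (move L (tape (map bit u) (bit b) (x ∷ r))) ∷ []
      go false = refl
      go true  = refl

    rewind : ∀ u l x r ol →
      config sC (move L (tape (syms b0 (length u) (blank ∷ l)) x r)) (at ol (map bit u ++ blank ∷ [])) ⟹[ length u ]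
      config sC (tape l blank (syms b0 (length u) (x ∷ r))) (tape (map bit u ʳ++ ol) blank [])
    rewind []      l x r ol = stop
    rewind (b ∷ u) l x r ol =
      then (go b) (rewind u l b0 (x ∷ r) (bit b ∷ ol))
        ▹ cong (λ z → config sC (tape l blank z) _) (syms-snoc b0 (length u) (x ∷ r))
      where
      k = syms b0 (length u) (blank ∷ l)
      go : ∀ b → succs D A (config sC (tape k b0 (x ∷ r)) (tape ol (bit b) (map bit u ++ blank ∷ [])))
                 ≡ config sC (move L (tape k b0 (x ∷ r))) (at (bit b ∷ ol) (map bit u ++ blank ∷ [])) ∷ []
      go false = cong (λ t → config sC _ t ∷ []) (move-R ol b0 _)
      go true  = cong (λ t → config sC _ t ∷ []) (move-R ol b1 _)

    back : ∀ k l x r ol →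
      config sK (move L (tape (syms b0 k (blank ∷ l)) x r)) (tape ol blank []) ⟹[ suc k ]
      config sD (at (blank ∷ l) (syms b0 k (x ∷ r))) (tape (syms b1 (suc k) ol) blank [])
    back zero    l x r ol = one refl
    back (suc k) l x r ol =
      then refl (back k l b0 (x ∷ r) (b1 ∷ ol))
        ▹ cong₂ (λ y z → config sD (at (blank ∷ l) y) (tape (b1 ∷ z) blank []))
            (syms-snoc b0 k (x ∷ r)) (syms-snoc b1 k ol)

    -- The cell next to the marker is the least significant. For `suc k` cells, the lower `k`
    -- overflow, the carry sets the last cell, the head returns, the lower `k` overflow again, and
    -- the carry clears the last cell.
    count : ∀ k l r ol →
      config sD (at (blank ∷ l) (syms b0 k r)) (tape ol blank []) ⟹[ countSteps k ]
      config sD (at (syms b0 k (blank ∷ l)) r) (tape (syms b1 (countSteps k) ol) blank [])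
    count zero    l r ol = stop
    count (suc k) l r ol =
      subst (λ y → config sD (at (blank ∷ l) y) (tape ol blank []) ⟹[ countSteps k ] _) (syms-snoc b0 k r)
        (count k l (b0 ∷ r) ol)
      ⨟ then refl (back k l b1 r _ ⨟ count k l (b1 ∷ r) _ ⨟
          one (cong (λ t → config sD t _ ∷ []) (move-R (syms b0 k (blank ∷ l)) b0 r)))
      ▹ cong (λ z → config sD _ (tape z blank [])) pushes
      where
      c = countSteps k
      open ≡-Reasoning
      pushes : b1 ∷ syms b1 c (syms b1 (suc k) (b1 ∷ syms b1 c ol)) ≡ syms b1 (countSteps (suc k)) ol
      pushes = begin
        syms b1 (1 + c) (syms b1 (suc k) (syms b1 (suc c) ol)) ≡⟨ cong (syms b1 (1 + c)) (syms-+ b1 (suc k) (suc c) ol) ⟩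
        syms b1 (1 + c) (syms b1 (suc k + suc c) ol)           ≡⟨ syms-+ b1 (1 + c) (suc k + suc c) ol ⟩
        syms b1 (1 + c + (suc k + suc c)) ol                   ≡⟨ cong (λ n → syms b1 n ol) (solve 2 (λ c k →
            con 1 :+ c :+ (con 1 :+ k :+ (con 1 :+ c)) := c :+ (con 1 :+ (con 1 :+ k :+ (c :+ con 1)))) refl c k) ⟩
        syms b1 (countSteps (suc k)) ol                        ∎
        where
        open +-*-Solver

    module _ (w : Word) where

      written : Word
      written = blocks w (false ∷ ones (suc e) [])

      width : ℕ
      width = length written

      -- The phases in order: header, copying, measuring, rewinding, counting. The single steps
      -- between and after them are the state changes.
      total : ℕ
      total = (2 + e) + (length w * (3 + e) + suc (width + suc (width + suc (countSteps width + 1))))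

      simulate : ∃ λ τ → ∃ λ ω → queryWord ω ≡ simWord e w (countSteps width) ×
        (initW D w ⟹[ total ] config sQ τ ω)
      simulate with copy w [] (false ∷ ones (suc e) [])
      ... | l , copied = _ , _ , word ,
        (header (suc e) (fromℕ (suc e)) (initTape w) [] (toℕ-fromℕ (suc e))
           ▹ cong (λ t → config rd t (onTape (false ∷ ones (suc e) []))) (initTape-at w))
        ⨟ copied
        ⨟ then refl (measure written (blank ∷ l) blank []
        ⨟ then (cong (λ t → config sC (move L (tape (syms b0 width (blank ∷ l)) blank [])) t ∷ []) turn)
               (rewound
        ⨟ then (cong (λ t → config sD t _ ∷ []) (move-R l blank _))
               (count width l (blank ∷ []) _ ⨟ one refl)))
        where
        turn : move R (tape [] blank (map bit written ʳ++ blank ∷ [])) ≡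
               at (blank ∷ []) (map bit (reverse written) ++ blank ∷ [])
        turn = trans (move-R [] blank _) (cong (at (blank ∷ [])) (map-bit-ʳ++ written (blank ∷ [])))

        rewound : config sC (move L (tape (syms b0 width (blank ∷ l)) blank []))
                    (at (blank ∷ []) (map bit (reverse written) ++ blank ∷ [])) ⟹[ width ]
                  config sC (tape l blank (syms b0 width (blank ∷ [])))
                    (tape (map bit (reverse written) ʳ++ blank ∷ []) blank [])
        rewound = subst (λ k → config sC (move L (tape (syms b0 k (blank ∷ l)) blank []))
                                 (at (blank ∷ []) (map bit (reverse written) ++ blank ∷ [])) ⟹[ k ]
                               config sC (tape l blank (syms b0 k (blank ∷ [])))
                                 (tape (map bit (reverse written) ʳ++ blank ∷ []) blank []))
                        (length-reverse written) (rewind (reverse written) l blank [] (blank ∷ []))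

        open ≡-Reasoning
        word : queryWord (tape (syms b1 (countSteps width) (map bit (reverse written) ʳ++ blank ∷ [])) blank []) ≡
               simWord e w (countSteps width)
        word = begin
          queryWord (tape (syms b1 t (map bit ŵ ʳ++ blank ∷ [])) blank [])
            ≡⟨ queryWord-left (syms b1 t (map bit ŵ ʳ++ blank ∷ [])) ⟩
          bitsOf (syms b1 t (map bit ŵ ʳ++ blank ∷ []) ʳ++ blank ∷ [])
            ≡⟨ cong bitsOf (syms-ʳ++ b1 t _ _) ⟩
          bitsOf ((map bit ŵ ʳ++ blank ∷ []) ʳ++ syms b1 t (blank ∷ []))
            ≡⟨ cong bitsOf (ʳ++-ʳ++ (map bit ŵ)) ⟩
          bitsOf (map bit ŵ ++ syms b1 t (blank ∷ []))
            ≡⟨ bitsOf-bits ŵ _ ⟩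
          ŵ ++ bitsOf (syms b1 t (blank ∷ []))
            ≡⟨ cong (ŵ ++_) (bitsOf-ones t (blank ∷ [])) ⟩
          reverse written ++ ones t []
            ≡⟨ ʳ++-defn written ⟨
          written ʳ++ ones t []
            ≡⟨ blocks-ʳ++ w (false ∷ ones (suc e) []) t ⟩
          (false ∷ ones (suc e) []) ʳ++ simTail e w t
            ≡⟨ ones-ʳ++ (suc e) [] (false ∷ simTail e w t) ⟩
          simWord e w t ∎
          where
          t = countSteps width
          ŵ = reverse written

      simulator-bounded : Bounded D A (total + 1) (initW D w)
      simulator-bounded with simulate
      ... | τ , ω , _ , run = ⟶-bounded D A run (bounded-step D A λ { _ (here refl) → final _ })
        where
        final : ∀ b → Bounded D A 0 (config (ans D sQ b) τ blankTape)
        final true  = bounded-stuck D A refl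
        final false = bounded-stuck D A refl

      simulator-accepts : A (decode (simWord e w (countSteps width))) ≡ true ⇔ AccEv D A (initW D w)
      simulator-accepts with simulate
      ... | τ , ω , eq , run = subst (λ u → A (decode u) ≡ true ⇔ AccEv D A (initW D w)) eq (mk⇔ to from)
        where
        to : A (decode (queryWord ω)) ≡ true → AccEv D A (initW D w)
        to ok = ⟶-accEv D A run (accEv-step D A (here refl)
          (0 , _ , done , subst (λ b → kindD (ans D sQ b) ≡ accept) (sym ok) refl))
        fin : ∀ b → AccEv D A (config (ans D sQ b) τ blankTape) → b ≡ true
        fin true  _ = refl
        fin false a with accEv-unstep D A (λ ()) a
        ... | _ , () , _
        from : AccEv D A (initW D w) → A (decode (queryWord ω)) ≡ true
        from a with accEv-unstep D A (λ ()) (⟶-unaccEv D A run a)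
        ... | _ , here refl , a' = fin _ a'

      width-≥ : suc (suc (length w) * suc e) ≤ width
      width-≥ = ≤-trans (≤-reflexive lem) (proj₁ (blocks-length w (false ∷ ones (suc e) [])))
        where
        lem : suc (suc e + length w * suc e) ≡ length w * suc e + (2 + length (ones e []))
        lem rewrite length-ones e [] | +-identityʳ e = +-comm (2 + e) (length w * suc e)

      width-≤ : width ≤ suc (length w) * (3 + e)
      width-≤ = ≤-trans (proj₂ (blocks-length w (false ∷ ones (suc e) []))) lem
        where
        lem : length w * (3 + e) + (2 + length (ones e [])) ≤ 3 + e + length w * (3 + e)
        lem rewrite length-ones e [] | +-identityʳ e | +-comm (length w * (3 + e)) (2 + e) = n≤1+n _

      -- The counter is as wide as the word written before it, so the clock is exponential in that
      -- word. The spare cell in `width-≥` absorbs the loss of one in `countSteps-≥`.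
      time-≥ : 2 ^ (suc (length w) * suc e) ≤ countSteps width
      time-≥ = ≤-pred (begin
        suc x                        ≤⟨ +-monoˡ-≤ x (m^n>0 2 (suc (length w) * suc e)) ⟩
        x + x                        ≡⟨ cong (x +_) (+-identityʳ x) ⟨
        2 ^ suc (suc (length w) * suc e) ≤⟨ ^-monoʳ-≤ 2 width-≥ ⟩
        2 ^ width                    ≤⟨ countSteps-≥ width ⟩
        suc (countSteps width)       ∎)
        where
        x = 2 ^ (suc (length w) * suc e)
        open ≤-Reasoning

      total-≤ : total + 1 ≤ 2 ^ ((7 + e) * (length w + 1))
      total-≤ = begin
        total + 1
          ≡⟨ solve 4 (λ e l k c → con 2 :+ e :+ (l :+ (con 1 :+ (k :+ (con 1 :+ (k :+ (con 1 :+ (c :+ con 1))))))) :+ con 1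
               := (con 2 :+ e :+ l) :+ (k :+ (c :+ k :+ con 4) :+ con 1)) refl e (length w * (3 + e)) width (countSteps width) ⟩
        (2 + e + length w * (3 + e)) + (width + (countSteps width + width + 4) + 1)
          ≤⟨ +-mono-≤ (n≤1+n _) (+-monoˡ-≤ 1 (+-mono-≤ width-≤ (countSteps-≤ width))) ⟩
        n + (n + 4 * 2 ^ width + 1)
          ≤⟨ +-mono-≤ n≤ (+-mono-≤ (+-mono-≤ n≤ (*-monoʳ-≤ 4 (^-monoʳ-≤ 2 width-≤))) (m^n>0 2 n)) ⟩
        2 ^ n + (2 ^ n + 4 * 2 ^ n + 2 ^ n)
          ≡⟨ solve 1 (λ p → p :+ (p :+ con 4 :* p :+ p) := con 7 :* p) refl (2 ^ n) ⟩
        -- Since 7 is at most 16, the factor costs 4 in the exponent; with the `3 + e` inside `n`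
        -- this gives `7 + e`.
        7 * 2 ^ n   ≤⟨ *-monoˡ-≤ (2 ^ n) (m≤m+n 7 9) ⟩
        2 ^ 4 * 2 ^ n ≡⟨ ^-distribˡ-+-* 2 4 n ⟨
        2 ^ (4 + n) ≤⟨ ^-monoʳ-≤ 2 (+-monoˡ-≤ n (m≤m*n 4 (suc (length w)))) ⟩
        2 ^ (4 * suc (length w) + n)
          ≡⟨ cong (2 ^_) (solve 2 (λ l e → con 4 :* (con 1 :+ l) :+ (con 1 :+ l) :* (con 3 :+ e) := (con 7 :+ e) :* (l :+ con 1)) refl (length w) e) ⟩
        2 ^ ((7 + e) * (length w + 1)) ∎
        where
        n = suc (length w) * (3 + e)
        n≤ : n ≤ 2 ^ n
        n≤ = <⇒≤ (n<2^n n)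
        open ≤-Reasoning
        open +-*-Solver

-- With an index `e` above the time constant, the single query written by `D` has a clock long
-- enough for every run of `M`, so its answer decides membership.
NE⊆E : ∀ O {X : Lang} → InNE ⌜ V O ⌝ X → InE ⌜ V O ⌝ X
NE⊆E O {X} (M , (c , tb) , ok) with mach-surjective M c
... | e , c≤e , M≈ , ≈M = D , D-deterministic ,
  (7 + e , λ n c' ss → <-irrefl refl (≤-trans (simulator-bounded A (encode n) _ c' ss) (total-≤ A (encode n)))) ,
  λ n → mk⇔ (to n) (from n)
  where
  open Simulator e
  open Run
  A = ⌜ V O ⌝

  module _ (n : ℕ) where
    w = encode n
    t = countSteps (width A w)
    q = simWord e w t

    answer : A (decode q) ≡ does (accIn? (mach e) A t w)
    answer = trans (cong (V O) (encode-decode q)) (V-sim O e w t admissible)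
      where
      admissible : decode w ≤ length q
      -- The number coded by `w` is less than `2 ^ suc (length w)`, hence below the clock, which the
      -- query contains in unary.
      admissible = ≤-trans (≤-pred (≤-pred (≤-trans (decode-bound w) (≤-trans (^-monoʳ-≤ 2 le)
                   (≤-trans (time-≥ A w) (≤-trans (n≤1+n t) (n≤1+n _)))))))
                   (<⇒≤ (simWord-pad e w t))
        where
        le : suc (length w) ≤ suc (length w) * suc e
        le = m≤m*n (suc (length w)) (suc e)

    enough : 2 ^ (c * (∣ n ∣ + 1)) ≤ t
    enough = ≤-trans (^-monoʳ-≤ 2 (≤-trans (≤-reflexive (trans (*-comm c _) (cong (_* c) (+-comm ∣ n ∣ 1))))
                       (*-monoʳ-≤ (suc ∣ n ∣) (≤-trans c≤e (n≤1+n e))))) (time-≥ A w)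

    to : X n → Accepts D A n
    to x with accepts⇒accIn {M} (λ m → 2 ^ (c * (m + 1))) n tb (Equivalence.to (ok n) x)
    ... | s , d , le , ss , k = Equivalence.to (simulator-accepts A w) (trans answer
          (dec-true (accIn? (mach e) A t w) (s , _ , ≤-trans le enough , cast-initSteps M≈ n ss , trans (_≈_.kindEq M≈ _) k)))

    from : Accepts D A n → X n
    from a with accIn? (mach e) A t w | trans (sym answer) (Equivalence.from (simulator-accepts A w) a)
    ... | yes acc | _ = Equivalence.from (ok n) (cast-accepts ≈M n (accIn⇒accepts t n acc))

-- The machines of the diagonal pair

-- The unary prefix gives every pair index its own blocks, so that stages for different pairs never
-- kill each other's blocks.
tag : ℕ → Word → Word
tag g w = ones g (false ∷ w)

length-tag : ∀ g w → length (tag g w) ≡ g + suc (length w)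
length-tag g w = length-ones g (false ∷ w)

tag-injective : ∀ g g' {w w'} → tag g w ≡ tag g' w' → g ≡ g'
tag-injective zero    zero     eq = refl
tag-injective (suc g) (suc g') eq = cong suc (tag-injective g g' (∷-injectiveʳ eq))

pattern nPre = zero
pattern nSep = suc zero
pattern nRd = suc (suc zero)
pattern nGs = suc (suc (suc zero))
pattern nAsk = suc (suc (suc (suc zero)))
pattern nAcc = suc (suc (suc (suc (suc zero))))
pattern nRej = suc (suc (suc (suc (suc (suc zero)))))
pattern nCh i = suc (suc (suc (suc (suc (suc (suc i))))))

module Guesser (g : ℕ) (i : Bool) where

  Q : Set
  Q = Fin (8 + g)

  kindN : Q → Kind
  kindN nAsk = query
  kindN nAcc = accept
  kindN nRej = reject
  kindN _    = normal

  -- nSep and nCh turn the input w into tag g w; nRd and nGs then write its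
  -- bits interleaved with guessed ones.
  δN : Q → Sym → Sym → List (Q × Sym × Move × Sym × Move)
  δN nPre w o      = (nSep , w , L , b0 , R) ∷ []
  δN nSep w o      = (nCh (fromℕ g) , b0 , L , bit i , R) ∷ []
  δN (nCh zero) w o    = (nRd , w , R , o , S) ∷ []
  δN (nCh (suc j)) w o = (nCh (inject₁ j) , b1 , L , o , S) ∷ []
  δN nRd blank o   = (nAsk , blank , S , o , S) ∷ []
  δN nRd b0 o      = (nGs , b0 , R , b0 , R) ∷ []
  δN nRd b1 o      = (nGs , b1 , R , b1 , R) ∷ []
  δN nGs w o       = (nRd , w , S , b0 , R) ∷ (nRd , w , S , b1 , R) ∷ []
  δN nAsk w o      = []
  δN nAcc w o      = []
  δN nRej w o      = []

  N : OTM
  N = record { nQ = 8 + g ; start = nPre ; kind = kindN ; δ = δN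
             ; ans = λ { _ true → nAcc ; _ false → nRej } }

  module _ (A : ℕ → Bool) where

    onTape : Word → Tape
    onTape u = tape (map bit u) blank []

    -- What follows the tagged input on the work tape: for an empty input, the first move to the
    -- left leaves the blank start cell there.
    data Pad : List Sym → Set where
      none : Pad []
      one  : Pad (blank ∷ [])

    queryWord-onTape : ∀ u → queryWord (onTape u) ≡ u ʳ++ []
    queryWord-onTape u = begin
      queryWord (onTape u)                      ≡⟨ queryWord-left (map bit u) ⟩
      bitsOf (map bit u ʳ++ blank ∷ [])         ≡⟨ cong bitsOf (map-bit-ʳ++ u _) ⟩
      bitsOf (map bit (reverse u) ++ blank ∷ []) ≡⟨ bitsOf-bits (reverse u) _ ⟩
      reverse u ++ []                           ≡⟨ ++-identityʳ _ ⟩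
      reverse u                                 ∎
      where open ≡-Reasoning

    chain : ∀ j k r o → toℕ k ≡ j →
      _⟶[_]_ N A (config (nCh k) (tape [] blank r) o) (suc j) (config nRd (at (blank ∷ []) (syms b1 j r)) o)
    chain zero    zero    r o eq = then (cong (λ t → config nRd t o ∷ []) (move-R [] blank r)) stop
    chain (suc j) (suc k) r o eq =
      then refl (land N A (chain j (inject₁ k) (b1 ∷ r) o (trans (toℕ-inject₁ k) (suc-injective eq)))
                          (cong (λ z → config nRd (at (blank ∷ []) z) o) (syms-snoc b1 j r)))

    read : ∀ b l v p u →
      succs N A (config nRd (at l (map bit (b ∷ v) ++ p)) (onTape u)) ≡
      config nGs (at (bit b ∷ l) (map bit v ++ p)) (onTape (b ∷ u)) ∷ []
    read false l v p u = cong (λ t → config nGs t _ ∷ []) (move-R l b0 (map bit v ++ p))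
    read true  l v p u = cong (λ t → config nGs t _ ∷ []) (move-R l b1 (map bit v ++ p))

    ask : ∀ {p} l u → Pad p → ∃ λ τ → succs N A (config nRd (at l p) (onTape u)) ≡ config nAsk τ (onTape u) ∷ []
    ask l u none = _ , refl
    ask l u one  = _ , refl

    loop-bounded : ∀ {p} → Pad p → ∀ v l u →
      Bounded N A (length v * 2 + 2) (config nRd (at l (map bit v ++ p)) (onTape u))
    loop-bounded pad [] l u with ask l u pad
    ... | τ , eq = ⟶-bounded N A (then eq stop) (bounded-step N A λ { _ (here refl) → final _ })
      where
      final : ∀ b → Bounded N A 0 (config (ans N nAsk b) τ blankTape)
      final true  = bounded-stuck N A refl
      final false = bounded-stuck N A refl
    loop-bounded pad (b ∷ v) l u = ⟶-bounded N A (then (read b l v _ u) stop)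
      (bounded-step N A λ { _ (here refl) → loop-bounded pad v (bit b ∷ l) (false ∷ b ∷ u)
                          ; _ (there (here refl)) → loop-bounded pad v (bit b ∷ l) (true ∷ b ∷ u) })

    loop-complete : ∀ {p} → Pad p → ∀ v l u y → length y ≡ length v → A (decode (u ʳ++ inter v y)) ≡ true →
      AccEv N A (config nRd (at l (map bit v ++ p)) (onTape u))
    loop-complete pad [] l u [] eq ok with ask l u pad
    ... | τ , e = ⟶-accEv N A (then e stop) (accEv-step N A (here refl) (0 , _ , done ,
        subst (λ b → kindN (ans N nAsk b) ≡ accept) (sym (trans (cong (λ z → A (decode z)) (queryWord-onTape u)) ok)) refl))
    loop-complete pad (b ∷ v) l u (false ∷ y) eq ok = ⟶-accEv N A (then (read b l v _ u) stop)
      (accEv-step N A (here refl) (loop-complete pad v _ (false ∷ b ∷ u) y (suc-injective eq) ok))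
    loop-complete pad (b ∷ v) l u (true ∷ y) eq ok = ⟶-accEv N A (then (read b l v _ u) stop)
      (accEv-step N A (there (here refl)) (loop-complete pad v _ (true ∷ b ∷ u) y (suc-injective eq) ok))

    loop-sound : ∀ {p} → Pad p → ∀ v l u → AccEv N A (config nRd (at l (map bit v ++ p)) (onTape u)) →
      ∃ λ y → length y ≡ length v × A (decode (u ʳ++ inter v y)) ≡ true
    loop-sound pad [] l u a with ask l u pad
    ... | τ , e with accEv-unstep N A (λ ()) (⟶-unaccEv N A (then e stop) a)
    ... | _ , here refl , a' = [] , refl , trans (cong (λ z → A (decode z)) (sym (queryWord-onTape u))) (fin _ a')
      where
      fin : ∀ b → AccEv N A (config (ans N nAsk b) τ blankTape) → b ≡ true
      fin true  _ = refl
      fin false a with accEv-unstep N A (λ ()) a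
      ... | _ , () , _
    loop-sound pad (b ∷ v) l u a
      with accEv-unstep N A (λ ()) (⟶-unaccEv N A (then (read b l v _ u) stop) a)
    ... | _ , here refl , a' with loop-sound pad v (bit b ∷ l) (false ∷ b ∷ u) a'
    ...   | y , eq , ok = false ∷ y , cong suc eq , ok
    loop-sound pad (b ∷ v) l u a | _ , there (here refl) , a' with loop-sound pad v (bit b ∷ l) (true ∷ b ∷ u) a'
    ...   | y , eq , ok = true ∷ y , cong suc eq , ok

    map-tag : ∀ k r w → syms b1 k (b0 ∷ map bit w ++ r) ≡ map bit (tag k w) ++ r
    map-tag zero    r w = refl
    map-tag (suc k) r w = cong (b1 ∷_) (map-tag k r w)

    prepare : ∀ w → ∃ λ p → Pad p ×
      _⟶[_]_ N A (initW N w) (3 + g) (config nRd (at (blank ∷ []) (map bit (tag g w) ++ p)) (onTape (i ∷ false ∷ [])))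
    prepare [] = _ , one , then refl (then refl (land N A
      (chain g (fromℕ g) (b0 ∷ blank ∷ []) (onTape (i ∷ false ∷ [])) (toℕ-fromℕ g))
      (cong (λ z → config nRd (at (blank ∷ []) z) _) (map-tag g (blank ∷ []) []))))
    prepare (b ∷ w) = _ , none , then refl (then refl (land N A
      (chain g (fromℕ g) (b0 ∷ map bit (b ∷ w)) (onTape (i ∷ false ∷ [])) (toℕ-fromℕ g))
      (cong (λ z → config nRd (at (blank ∷ []) z) _)
        (trans (cong (λ z → syms b1 g (b0 ∷ z)) (sym (++-identityʳ (map bit (b ∷ w))))) (map-tag g [] (b ∷ w))))))

    guesser-complete : ∀ n y → length y ≡ length (tag g (encode n)) →
      A (decode (freeWord i (tag g (encode n)) y)) ≡ true → Accepts N A n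
    guesser-complete n y eq ok with prepare (encode n)
    ... | p , pad , run = ⟶-accEv N A run (loop-complete pad (tag g (encode n)) _ _ y eq ok)

    guesser-sound : ∀ n → Accepts N A n → ∃ λ y → length y ≡ length (tag g (encode n)) ×
      A (decode (freeWord i (tag g (encode n)) y)) ≡ true
    guesser-sound n a with prepare (encode n)
    ... | p , pad , run = loop-sound pad (tag g (encode n)) _ _ (⟶-unaccEv N A run a)

    guesser-poly : PolyTime N A
    -- The bound is `2 * m + 7 + 3 * g` for inputs of length `m`, and `double` bounds `m + m` by
    -- `m ^ k + 2`; the 2 covers `m = 1`.
    guesser-poly = 9 + 3 * g , λ n c ss → <-irrefl refl (≤-trans (bound n _ c ss) (le (encode n)))
      where
      bound : ∀ n → Bounded N A (3 + g + (length (tag g (encode n)) * 2 + 2)) (init N n)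
      bound n with prepare (encode n)
      ... | p , pad , run = ⟶-bounded N A run (loop-bounded pad (tag g (encode n)) _ _)
      open ≤-Reasoning
      open +-*-Solver
      double : ∀ k m → 2 ≤ k → m + m ≤ m ^ k + 2
      double k 0 _ = z≤n
      double k 1 _ = m≤n+m 2 (1 ^ k)
      double k m@(suc (suc _)) 2≤k = begin
        m + m       ≡⟨ cong (m +_) (+-identityʳ m) ⟨
        2 * m       ≤⟨ *-monoˡ-≤ m {2} {m} (s≤s (s≤s z≤n)) ⟩
        m * m       ≡⟨ cong (m *_) (*-identityʳ m) ⟨
        m ^ 2       ≤⟨ ^-monoʳ-≤ m 2≤k ⟩
        m ^ k       ≤⟨ m≤m+n _ 2 ⟩
        m ^ k + 2   ∎
      le : ∀ w → 3 + g + (length (tag g w) * 2 + 2) ≤ length w ^ (9 + 3 * g) + (9 + 3 * g)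
      le w = begin
        3 + g + (length (tag g w) * 2 + 2)
          ≡⟨ cong (λ k → 3 + g + (k * 2 + 2)) (length-tag g w) ⟩
        3 + g + ((g + suc m) * 2 + 2)
          ≡⟨ solve 2 (λ g m → con 3 :+ g :+ ((g :+ (con 1 :+ m)) :* con 2 :+ con 2) := m :+ m :+ (con 7 :+ con 3 :* g)) refl g m ⟩
        m + m + (7 + 3 * g)                   ≤⟨ +-monoˡ-≤ _ (double (9 + 3 * g) m (s≤s (s≤s z≤n))) ⟩
        m ^ (9 + 3 * g) + 2 + (7 + 3 * g)     ≡⟨ +-assoc (m ^ (9 + 3 * g)) 2 _ ⟩
        m ^ (9 + 3 * g) + (9 + 3 * g)         ∎
        where m = length w

-- Forcing

-- The double negation monad: forcing asks whether some oracle makes a machine accept, which is not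
-- decidable in general.
_>>=_ : ∀ {X Y : Set} → ¬ ¬ X → (X → ¬ ¬ Y) → ¬ ¬ Y
(m >>= f) k = m λ x → f x k

return : ∀ {X : Set} → X → ¬ ¬ X
return x k = k x

length-cartesianProductWith : ∀ {X Y Z : Set} (f : X → Y → Z) xs ys →
  length (cartesianProductWith f xs ys) ≡ length xs * length ys
length-cartesianProductWith f []       ys = refl
length-cartesianProductWith f (x ∷ xs) ys = trans (length-++ (map (f x) ys))
  (cong₂ _+_ (length-map (f x) ys) (length-cartesianProductWith f xs ys))

module Forcing (z : ℕ) where

  -- The pair of `O` and `P` acts as a forcing condition: bits up to length `z` and the reserved
  -- bits in `P` are kept, all others may still change.
  record Agree (P : List Word) (O O' : Oracle) : Set where
    constructor agree
    field
      low  : ∀ q → length q ≤ z → O q ≡ O' q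
      high : All (λ q → O q ≡ O' q) P

  open Agree public

  agree-refl : ∀ {P O} → Agree P O O
  agree-refl = agree (λ _ _ → refl) (All.universal (λ _ → refl) _)

  agree-trans : ∀ {P O O' O''} → Agree P O O' → Agree P O' O'' → Agree P O O''
  agree-trans (agree l h) (agree l' h') =
    agree (λ q le → trans (l q le) (l' q le)) (All.zipWith (λ { (e , e') → trans e e' }) (h , h'))

  agree-right : ∀ P' {P O O'} → Agree (P' ++ P) O O' → Agree P O O'
  agree-right P' (agree l h) = agree l (++⁻ʳ P' h)

  Stable : Oracle → List Word → Word → Set
  Stable O P u = ∀ O' → Agree P O O' → V O u ≡ V O' u

  Forced : ℕ → Oracle → List Word → Set
  Forced l O P = ∀ u {p} → length u < l → sim u ≡ just p → Stable O P u

  stable-mono : ∀ {O P O₁} P' {u} → Agree P O O₁ → Stable O P u → Stable O₁ (P' ++ P) u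
  stable-mono P' ag st O' ag' =
    trans (sym (st _ ag)) (st O' (agree-trans ag (agree-right P' ag')))

  -- A short word is either a simulation query, whose answer is forced, or a free bit, whose answer
  -- is the oracle bit itself.
  V-agree : ∀ {l O P O'} → Forced l O P → ∀ {O₁} → Agree P O O₁ → Agree P O O' →
    ∀ q → length q < l → O₁ q ≡ O' q → V O₁ q ≡ V O' q
  V-agree {O = O} {O' = O'} fo {O₁} ag ag' q lt eq with sim q in s
  ... | just p  = trans (sym (fo q lt s O₁ ag)) (fo q lt s O' ag')
  ... | nothing = trans (free O₁) (trans eq (sym (free O')))
    where
    free : ∀ O → V O q ≡ O q
    free O = trans (V-eq O q) (cong (value O (V O) q) s)

  record Extension (l k : ℕ) (O : Oracle) (P : List Word) (Good : Oracle → List Word → Set) : Set where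
    constructor extension
    field
      oracle'  : Oracle
      reserved : List Word
      agrees   : Agree P O oracle'
      few      : length reserved ≤ k
      short    : All (λ q → length q ≤ l) reserved
      good     : Good oracle' (reserved ++ P)

  -- If some agreeing oracle lets the simulated machine accept, that oracle is taken and the queries
  -- of one accepting path are reserved. Simulation queries on the path are shorter than `u`, hence
  -- forced already, so the path survives. Otherwise the answer is `false` under every agreeing
  -- oracle.
  forceWord : ∀ l O P → Forced l O P → ∀ u → length u ≤ l →
    ¬ ¬ Extension l l O P (λ O₁ P₁ → Stable O₁ P₁ u ⊎ sim u ≡ nothing)
  forceWord l O P fo u le with sim u in s
  ... | nothing = return (extension O [] agree-refl z≤n [] (inj₂ refl))
  ... | just (e , w , t) with sim-sound u s
  ... | refl , adm = do
    yes (O₁ , ag , acc) ← ¬¬-excluded-middle {A = ∃ λ O₁ → Agree P O O₁ × AccIn (mach e) ⌜ V O₁ ⌝ t w}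
      where no none → return (extension O [] agree-refl z≤n [] (inj₁ λ O' ag →
              trans (rejecting O λ acc → none (O , agree-refl , acc))
                    (sym (rejecting O' λ acc → none (O' , ag , acc)))))
    let Q , few , short , ok = accIn-cert (mach e) {V O₁} acc
        t<l = <-≤-trans (simWord-pad e w t) le
    return (extension O₁ Q ag (≤-trans few (<⇒≤ t<l))
      (All.map (λ lt → ≤-trans (≤-pred lt) (<⇒≤ t<l)) short)
      (inj₁ λ O' ag' → trans (accepting O₁ acc) (sym (accepting O' (ok (V O')
        (All.zipWith (λ { (lt , eq) → V-agree fo ag (agree-trans ag (agree-right Q ag')) _ (<-≤-trans lt t<l) eq })
                     (short , ++⁻ˡ Q (high ag'))))))))
    where
    accepting : ∀ O → AccIn (mach e) ⌜ V O ⌝ t w → V O (simWord e w t) ≡ true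
    accepting O acc = trans (V-sim O e w t adm) (dec-true (accIn? (mach e) ⌜ V O ⌝ t w) acc)
    rejecting : ∀ O → ¬ AccIn (mach e) ⌜ V O ⌝ t w → V O (simWord e w t) ≡ false
    rejecting O rej = trans (V-sim O e w t adm) (dec-false (accIn? (mach e) ⌜ V O ⌝ t w) rej)

  forceList : ∀ l O P → Forced l O P → ∀ us →
    ¬ ¬ Extension l (length us * l) O P (λ O₁ P₁ → Forced l O₁ P₁ ×
          All (λ u → length u ≤ l → Stable O₁ P₁ u ⊎ sim u ≡ nothing) us)
  forceList l O P fo [] = return (extension O [] agree-refl z≤n [] (fo , []))
  forceList l O P fo (u ∷ us) with length u ≤? l
  ... | no nle = do
    extension O₁ P₁ ag few short (fo₁ , st) ← forceList l O P fo us
    return (extension O₁ P₁ ag (≤-trans few (m≤n+m _ l)) short (fo₁ , (λ le → ⊥-elim (nle le)) ∷ st))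
  ... | yes le = do
    extension O₁ P₁ ag₁ few₁ short₁ st₁ ← forceWord l O P fo u le
    extension O₂ P₂ ag₂ few₂ short₂ (fo₂ , st₂) ←
      forceList l O₁ (P₁ ++ P) (λ v lt s → stable-mono P₁ ag₁ (fo v lt s)) us
    let eq = ++-assoc P₂ P₁ P
    return (extension O₂ (P₂ ++ P₁) (agree-trans ag₁ (agree-right P₁ ag₂))
      (begin
        length (P₂ ++ P₁)        ≡⟨ length-++ P₂ ⟩
        length P₂ + length P₁    ≤⟨ +-mono-≤ few₂ few₁ ⟩
        length us * l + l        ≡⟨ +-comm (length us * l) l ⟩
        l + length us * l        ∎)
      (++⁺ short₂ short₁)
      (subst (Forced l O₂) (sym eq) fo₂ ,
       (λ _ → Sum.map₁ (λ st → subst (λ p → Stable O₂ p u) (sym eq) (stable-mono P₂ ag₂ st)) st₁) ∷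
       subst (λ p → All (λ u → length u ≤ l → Stable O₂ p u ⊎ sim u ≡ nothing) us) (sym eq) st₂))
    where open ≤-Reasoning

  below : ℕ → List ℕ
  below l = upTo (suc l)

  pairsBelow : ℕ → List (ℕ × ℕ)
  pairsBelow l = cartesianProductWith _,_ (below l) (below l)

  simWordOf : ℕ → ℕ × ℕ → Word
  simWordOf e (n , t) = simWord e (encode n) t

  -- For an admissible query of length `l`, the index, the number coded by the input and the clock
  -- are all at most `l`, so a cubic number of triples suffices.
  simWords : ℕ → List Word
  simWords l = cartesianProductWith simWordOf (below l) (pairsBelow l)

  simWords-complete : ∀ u {p} → sim u ≡ just p → u ∈ simWords (length u)
  simWords-complete u s with sim-sound u s
  simWords-complete u {e , w , t} s | refl , adm = subst (λ w' → simWord e w' t ∈ simWords (length u)) (encode-decode w)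
    (∈-cartesianProductWith⁺ simWordOf (∈-upTo⁺ (s≤s (simWord-index e w t)))
      (∈-cartesianProductWith⁺ _,_ (∈-upTo⁺ (s≤s adm)) (∈-upTo⁺ (s≤s (<⇒≤ (simWord-pad e w t))))))

  simWords-length : ∀ l → length (simWords l) ≡ suc l * (suc l * suc l)
  simWords-length l = trans (length-cartesianProductWith simWordOf (below l) (pairsBelow l))
    (cong₂ _*_ (length-upTo (suc l)) (trans (length-cartesianProductWith _,_ (below l) (below l))
      (cong₂ _*_ (length-upTo (suc l)) (length-upTo (suc l)))))

  -- There are `l` lengths below `l`, each with at most `l ^ 3` listed queries, and each of these
  -- reserves at most `l` words.
  forceBound : ℕ → ℕ
  forceBound l = l * (l * (l * l) * l)

  -- By increasing length, because a simulation query depends on shorter queries only.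
  force : ∀ l O → ¬ ¬ Extension l (forceBound l) O [] (λ O₁ P₁ → Forced l O₁ P₁)
  force zero    O = return (extension O [] agree-refl z≤n [] λ u ())
  force (suc l) O = do
    extension O₁ P₁ ag₁ few₁ short₁ fo₁ ← force l O
    extension O₂ P₂ ag₂ few₂ short₂ (fo₂ , st) ← forceList l O₁ (P₁ ++ []) fo₁ (simWords l)
    let eq = ++-assoc P₂ P₁ []
    return (extension O₂ (P₂ ++ P₁) (agree-trans ag₁ (agree (low ag₂) []))
      (begin
        length (P₂ ++ P₁)                                ≡⟨ length-++ P₂ ⟩
        length P₂ + length P₁                            ≤⟨ +-mono-≤ few₂ few₁ ⟩
        length (simWords l) * l + forceBound l           ≡⟨ cong (λ n → n * l + forceBound l) (simWords-length l) ⟩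
        suc l * (suc l * suc l) * l + forceBound l
          ≤⟨ +-mono-≤ (*-monoʳ-≤ (suc l * (suc l * suc l)) (n≤1+n l))
               (*-monoʳ-≤ l (*-mono-≤ (*-mono-≤ (n≤1+n l) (*-mono-≤ (n≤1+n l) (n≤1+n l))) (n≤1+n l))) ⟩
        forceBound (suc l) ∎)
      (All.map m≤n⇒m≤1+n (++⁺ short₂ short₁))
      (subst (Forced (suc l) O₂) (sym eq) λ u lt s → decided u (≤-pred lt) s fo₂ st))
    where
    open ≤-Reasoning
    decided : ∀ {O₂ P₂} u {p} → length u ≤ l → sim u ≡ just p → Forced l O₂ P₂ →
      All (λ u → length u ≤ l → Stable O₂ P₂ u ⊎ sim u ≡ nothing) (simWords l) → Stable O₂ P₂ u
    decided u le s fo st with m≤n⇒m<n∨m≡n le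
    ... | inj₁ lt   = fo u lt s
    ... | inj₂ refl with All.lookup st (simWords-complete u s) ≤-refl
    ...   | inj₁ x = x
    ...   | inj₂ n with () ← trans (sym n) s

-- One stage of the construction

-- The treatment of the block of the diagonal input n: kill is used when both
-- machines reject F(n), so that their pair is not disjoint; side i puts n into
-- the i-th diagonal set when machine i accepts F(n); none is used when F fails.
data Opt : Set where
  none kill : Opt
  side      : Bool → Opt

hits : Opt → Bool → Bool
hits none     i = false
hits kill     i = true
hits (side b) i = does (b Bool.≟ i)

Hit : Opt → Word → Word → Set
Hit o v (false ∷ i ∷ z) = hits o i ≡ true × evens z ≡ v
Hit o v _               = ⊥

hit? : ∀ o v u → Dec (Hit o v u)
hit? o v []              = no λ ()
hit? o v (true ∷ u)      = no λ ()
hit? o v (false ∷ [])    = no λ ()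
hit? o v (false ∷ i ∷ z) = (hits o i Bool.≟ true) ×-dec (evens z ≟ʷ v)

hit⇒kill : ∀ o v u → Hit o v u → Hit kill v u
hit⇒kill o v (false ∷ i ∷ z) (_ , eq) = refl , eq

-- Reads `n` off any bit in the block of `tag g n`; an `n` outside `map (untag g) P` therefore has a
-- block without reserved bits.
untag : ℕ → Word → Word
untag g (false ∷ i ∷ z) = drop (suc g) (evens z)
untag g _               = []

drop-tag : ∀ g n → drop (suc g) (tag g n) ≡ n
drop-tag zero    n = refl
drop-tag (suc g) n = drop-tag g n

hit-untag : ∀ o g n u → Hit o (tag g n) u → untag g u ≡ n
hit-untag o g n (false ∷ i ∷ z) (_ , eq) = trans (cong (drop (suc g)) eq) (drop-tag g n)

open import Data.List.Membership.DecPropositional _≟ʷ_ using (_∈?_)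

module Extend (O : Oracle) (z g : ℕ) where

  open Forcing z

  abstract
    -- Above length `z` all bits are true except those in `Z` and the hit sides of one block. Such
    -- an oracle has a finite description, so it can be searched for.
    ext : Word → Opt → List Word → Oracle
    ext n o Z u with length u ≤? z | u ∈? Z | hit? o (tag g n) u
    ... | yes _ | _     | _     = O u
    ... | no _  | yes _ | _     = false
    ... | no _  | no _  | yes _ = false
    ... | no _  | no _  | no _  = true

    ext-low : ∀ n o Z u → length u ≤ z → ext n o Z u ≡ O u
    ext-low n o Z u le with length u ≤? z | u ∈? Z | hit? o (tag g n) u
    ... | yes _  | _ | _ = refl
    ... | no nle | _ | _ = ⊥-elim (nle le)

    ext-∈ : ∀ n o Z u → z < length u → u ∈ Z → ext n o Z u ≡ false
    ext-∈ n o Z u lt m with length u ≤? z | u ∈? Z | hit? o (tag g n) u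
    ... | yes le | _     | _ = ⊥-elim (<⇒≱ lt le)
    ... | no _   | yes _ | _ = refl
    ... | no _   | no nm | _ = ⊥-elim (nm m)

    ext-hit : ∀ n o Z u → z < length u → Hit o (tag g n) u → ext n o Z u ≡ false
    ext-hit n o Z u lt h with length u ≤? z | u ∈? Z | hit? o (tag g n) u
    ... | yes le | _     | _     = ⊥-elim (<⇒≱ lt le)
    ... | no _   | yes _ | _     = refl
    ... | no _   | no _  | yes _ = refl
    ... | no _   | no _  | no nh = ⊥-elim (nh h)

    ext-true : ∀ n o Z u → z < length u → u ∉ Z → ¬ Hit o (tag g n) u → ext n o Z u ≡ true
    ext-true n o Z u lt nm nh with length u ≤? z | u ∈? Z | hit? o (tag g n) u
    ... | yes le | _     | _     = ⊥-elim (<⇒≱ lt le)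
    ... | no _   | yes m | _     = ⊥-elim (nm m)
    ... | no _   | no _  | yes h = ⊥-elim (nh h)
    ... | no _   | no _  | no _  = refl

  falses : Oracle → List Word → List Word
  falses E = filter (λ q → E q Bool.≟ false)

  -- An arbitrary oracle is replaced by a finitely described one with the same bits on `P`: the
  -- false ones go into `Z`, and the true ones must avoid the hit sides.
  ext-agree : ∀ {E} n o P → Agree [] O E →
    (∀ q → q ∈ P → z < length q → E q ≡ true → ¬ Hit o (tag g n) q) →
    Agree P E (ext n o (falses E P))
  ext-agree {E} n o P ag nohit = agree
    (λ q le → trans (sym (low ag q le)) (sym (ext-low n o _ q le)))
    (All.tabulate λ {q} m → eq q m)
    where
    eq : ∀ q → q ∈ P → E q ≡ ext n o (falses E P) q
    eq q m with length q ≤? z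
    ... | yes le = trans (sym (low ag q le)) (sym (ext-low n o _ q le))
    ... | no nle with E q in e
    ...   | false = sym (ext-∈ n o _ q (≰⇒> nle) (∈-filter⁺ (λ q → E q Bool.≟ false) m e))
    ...   | true  = sym (ext-true n o _ q (≰⇒> nle) nm (nohit q m (≰⇒> nle) e))
      where
      nm : q ∉ falses E P
      nm m' with () ← trans (sym e) (proj₂ (∈-filter⁻ (λ q → E q Bool.≟ false) {xs = P} m'))

module Stage (M : Bool → OTM) (k : Bool → ℕ) (MF : OTM) (kF g m : ℕ) where

  -- `T` is the clock of the reduction, `X` bounds the length of its output on inputs of length `m`,
  -- and `l` bounds every clock that occurs, hence every query asked.
  T X l : ℕ
  T = m ^ kF + kF
  X = suc m + T
  l = T + ((X ^ k false + k false) + (X ^ k true + k true))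

  clock : Bool → Word → ℕ
  clock i x = length x ^ k i + k i

  final : Oracle → Word → Config MF
  final A n = run MF ⌜ A ⌝ T (initW MF n)

  result : Oracle → Word → Word
  result A n = output (final A n)

  Acc : Bool → Oracle → Word → Set
  Acc i A x = AccIn (M i) ⌜ A ⌝ (clock i x) x

  Verdict : Opt → Oracle → Word → Set
  Verdict none     A n = ¬ Accepting MF (final A n)
  Verdict kill     A n = Accepting MF (final A n) × ¬ Acc false A (result A n) × ¬ Acc true A (result A n)
  Verdict (side i) A n = Accepting MF (final A n) × Acc i A (result A n)

  acc? : ∀ i A x → Dec (Acc i A x)
  acc? i A x = accIn? (M i) ⌜ A ⌝ (clock i x) x

  verdict? : ∀ o A n → Dec (Verdict o A n)
  verdict? none     A n = ¬? (accept? _)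
  verdict? kill     A n = accept? _ ×-dec (¬? (acc? false A _) ×-dec ¬? (acc? true A _))
  verdict? (side i) A n = accept? _ ×-dec acc? i A _

  result-length : ∀ A n → length n ≡ m → length (result A n) ≤ X
  result-length A n eq = subst (λ j → length (result A n) ≤ suc j + T) eq (run-output MF ⌜ A ⌝ T n)

  T≤l : T ≤ l
  T≤l = m≤m+n T _

  clock≤l : ∀ i x → length x ≤ X → clock i x ≤ l
  clock≤l false x le = ≤-trans (+-monoˡ-≤ _ (^-monoˡ-≤ (k false) le)) (≤-trans (m≤m+n _ _) (m≤n+m _ T))
  clock≤l true  x le = ≤-trans (+-monoˡ-≤ _ (^-monoˡ-≤ (k true) le)) (≤-trans (m≤n+m (X ^ k true + k true) (X ^ k false + k false)) (m≤n+m _ T))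

  module _ {A B : Oracle} (ag : ∀ q → length q ≤ l → A q ≡ B q) where

    final-local : ∀ n → final B n ≡ final A n
    final-local n = run-local MF T n (λ q le → ag q (≤-trans le T≤l))

    acc-local : ∀ i x → length x ≤ X → Acc i A x → Acc i B x
    acc-local i x le = accIn-local (M i) (λ q lq → ag q (≤-trans lq (clock≤l i x le)))

  -- The bits reserved by forcing, then at most `l` queries of the reduction and at most `l` of an
  -- accepting path.
  reserve : ℕ
  reserve = Forcing.forceBound 0 (suc l) + (l + l)

  module _ (O : Oracle) where

    -- A word in the block of `v` has length `2 + (length v + length v)`. So a block lies wholly up
    -- to `z` if `length v < m`, and wholly above `z` otherwise.
    z : ℕ
    z = suc (m + m)

    open Forcing z
    open Extend O z g

    -- The part of the outcome that is decidable. With `few`, `Z` cannot cover a side of a block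
    -- above `z`, which has at least `2 ^ m` bits.
    record Test (n : Word) (o : Opt) (Z : List Word) : Set where
      constructor test
      field
        lengthₙ : length n ≡ m
        few     : length Z < 2 ^ m
        verdict : Verdict o (V (ext n o Z)) n

    Short : List Word → Set
    Short = All (λ q → length q ≤ suc l)

    Found : Set
    Found = ∃ λ n → ∃ λ o → ∃ λ Z → Short Z × Test n o Z

    stage : reserve < 2 ^ m → ¬ ¬ Found
    stage room = do
      extension O₁ P ag few short fo ← force (suc l) O
      return (build O₁ (P ++ []) ag (subst (_≤ forceBound (suc l)) (cong length (sym (++-identityʳ P))) few)
                    (++⁺ short []) fo)
      where
      module _ (O₁ : Oracle) (P : List Word) (ag : Agree [] O O₁) (few : length P ≤ forceBound (suc l))
               (short : Short P) (fo : Forced (suc l) O₁ P) where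

        few< : length (map (untag g) P) < 2 ^ m
        few< = ≤-<-trans (≤-trans (≤-reflexive (length-map (untag g) P)) (≤-trans few (m≤m+n _ _))) room

        n : Word
        n = proj₁ (fresh m (map (untag g) P) few<)

        n-length : length n ≡ m
        n-length = proj₁ (proj₂ (fresh m (map (untag g) P) few<))

        unhit : ∀ q → q ∈ P → ¬ Hit kill (tag g n) q
        unhit q q∈ h = proj₂ (proj₂ (fresh m (map (untag g) P) few<))
          (subst (_∈ map (untag g) P) (hit-untag kill g n q h) (∈-map⁺ (untag g) q∈))

        E : Oracle
        -- The reference oracle: the whole block of `n` is false. The choice of option is read off
        -- from the machines under this oracle.
        E = ext n kill (falses O₁ P)

        O₁E : Agree P O₁ E
        O₁E = ext-agree n kill P ag (λ q q∈ _ _ → unhit q q∈)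

        OE : Agree [] O E
        OE = agree (λ q le → sym (ext-low n kill _ q le)) []

        module _ (o : Opt) (Q : List Word) where

          E' : Oracle
          E' = ext n o (falses E (Q ++ P))

          EE' : Agree (Q ++ P) E E'
          -- A bit above `z` that is true in `E` lies outside the block of `n`, so no option
          -- conflicts with keeping it.
          EE' = ext-agree n o (Q ++ P) OE λ q _ lt e h → lem (trans (sym e)
                  (ext-hit n kill _ q lt (hit⇒kill o (tag g n) q h)))
            where
            lem : true ≡ false → ⊥
            lem ()

          V-transfer : All (λ q → length q < suc l) Q → All (λ q → V E q ≡ V E' q) Q
          V-transfer sh = All.zipWith (λ { (lt , eq) →
              V-agree fo O₁E (agree-trans O₁E (agree-right Q EE')) _ lt eq }) (sh , ++⁻ˡ Q (high EE'))

          conclude : length Q ≤ l + l → All (λ q → length q < suc l) Q → Verdict o (V E') n → Found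
          conclude le sh v = n , o , falses E (Q ++ P) ,
            filter⁺ (λ q → E q Bool.≟ false) (++⁺ (All.map <⇒≤ sh) short) ,
            test n-length (≤-<-trans (begin
              length (falses E (Q ++ P)) ≤⟨ length-filter (λ q → E q Bool.≟ false) (Q ++ P) ⟩
              length (Q ++ P)            ≡⟨ length-++ Q ⟩
              length Q + length P        ≡⟨ +-comm (length Q) _ ⟩
              length P + length Q        ≤⟨ +-mono-≤ few le ⟩
              reserve                    ∎) room) v
            where open ≤-Reasoning

        x : Word
        x = result (V E) n

        finalCert : Cert T (suc T) (V E) (λ B → run MF ⌜ B ⌝ T (initW MF n) ≡ final (V E) n)
        finalCert = run-cert MF T (initW MF n) (initW-small MF n)

        QF : List Word
        QF = proj₁ finalCert

        QF-short : All (λ q → length q < suc l) QF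
        QF-short = All.map (λ lt → <-≤-trans lt (s≤s T≤l)) (proj₁ (proj₂ (proj₂ finalCert)))

        QF-few : length QF ≤ l
        QF-few = ≤-trans (proj₁ (proj₂ finalCert)) T≤l

        final-same : ∀ B → All (λ q → V E q ≡ B q) QF → final B n ≡ final (V E) n
        final-same = proj₂ (proj₂ (proj₂ finalCert))

        rejected : ¬ Accepting MF (final (V E) n) → Found
        rejected na = conclude none QF (≤-trans QF-few (m≤m+n l l)) QF-short
          (subst (λ c → ¬ Accepting MF c) (sym (final-same _ (V-transfer none QF QF-short))) na)

        killed : Accepting MF (final (V E) n) → ¬ Acc false (V E) x → ¬ Acc true (V E) x → Found
        -- Here `E` itself is the chosen oracle, so both rejections hold without any transfer.
        killed ac r₀ r₁ = n , kill , falses O₁ P , filter⁺ (λ q → O₁ q Bool.≟ false) short ,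
          test n-length (≤-<-trans (length-filter (λ q → O₁ q Bool.≟ false) P)
            (≤-<-trans (≤-trans few (m≤m+n _ _)) room)) (ac , r₀ , r₁)

        accepted : ∀ i → Accepting MF (final (V E) n) → Acc i (V E) x → Found
        accepted i ac a = conclude (side i) (QF ++ Q) (≤-trans (≤-reflexive (length-++ QF)) (+-mono-≤ QF-few Q-few))
            (++⁺ QF-short Q-short) (subst (Accepting MF) (sym same) ac ,
              subst (λ c → Acc i B (output c)) (sym same) (ok B (++⁻ʳ QF transfer)))
          where
          c≤l = clock≤l i x (result-length (V E) n n-length)
          cert = accIn-cert (M i) {V E} a
          Q = proj₁ cert
          ok = proj₂ (proj₂ (proj₂ cert))
          Q-few = ≤-trans (proj₁ (proj₂ cert)) c≤l
          Q-short = All.map (λ lt → <-≤-trans lt (s≤s c≤l)) (proj₁ (proj₂ (proj₂ cert)))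
          B = V (E' (side i) (QF ++ Q))
          transfer = V-transfer (side i) (QF ++ Q) (++⁺ QF-short Q-short)
          same = final-same B (++⁻ˡ QF transfer)

        build : Found
        build with accept? (kind MF (Config.state (final (V E) n)))
        ... | no na  = rejected na
        ... | yes ac with acc? false (V E) x | acc? true (V E) x
        ...   | yes a | _     = accepted false ac a
        ...   | no _  | yes a = accepted true ac a
        ...   | no r₀ | no r₁ = killed ac r₀ r₁

-- The search of a stage

-- Polynomial growth tested at powers of two only, where sums and products reduce to arithmetic of
-- exponents.
record PolyBounded (f : ℕ → ℕ) : Set where
  constructor _,ₚ_
  field
    exponent : ℕ
    bound    : ∀ j → f (2 ^ j) ≤ 2 ^ (exponent * suc j)

poly-const : ∀ c → PolyBounded (λ _ → c)
poly-const c = c ,ₚ λ j → ≤-trans (<⇒≤ (n<2^n c)) (^-monoʳ-≤ 2 (m≤m*n c (suc j)))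

poly-id : PolyBounded (λ m → m)
poly-id = 1 ,ₚ λ j → ^-monoʳ-≤ 2 (≤-trans (n≤1+n j) (m≤m+n (suc j) 0))

poly-* : ∀ {f g} → PolyBounded f → PolyBounded g → PolyBounded (λ m → f m * g m)
poly-* (a ,ₚ p) (b ,ₚ q) = (a + b) ,ₚ λ j → ≤-trans (*-mono-≤ (p j) (q j))
  (≤-reflexive (trans (sym (^-distribˡ-+-* 2 (a * suc j) (b * suc j))) (cong (2 ^_) (sym (*-distribʳ-+ (suc j) a b)))))

poly-+ : ∀ {f g} → PolyBounded f → PolyBounded g → PolyBounded (λ m → f m + g m)
poly-+ {f} {g} (a ,ₚ p) (b ,ₚ q) = suc (a + b) ,ₚ λ j → begin
  f (2 ^ j) + g (2 ^ j)                         ≤⟨ +-mono-≤ (p j) (q j) ⟩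
  2 ^ (a * suc j) + 2 ^ (b * suc j)             ≤⟨ +-mono-≤ (^-monoʳ-≤ 2 (*-monoˡ-≤ (suc j) (m≤m+n a b)))
                                                            (^-monoʳ-≤ 2 (*-monoˡ-≤ (suc j) (m≤n+m b a))) ⟩
  2 ^ ((a + b) * suc j) + 2 ^ ((a + b) * suc j) ≡⟨ cong (2 ^ ((a + b) * suc j) +_) (+-identityʳ _) ⟨
  2 ^ suc ((a + b) * suc j)                     ≤⟨ ^-monoʳ-≤ 2 (s≤s (m≤n+m _ j)) ⟩
  2 ^ (suc (a + b) * suc j)                     ∎
  where open ≤-Reasoning

poly-^ : ∀ {f} k → PolyBounded f → PolyBounded (λ m → f m ^ k)
poly-^ {f} zero    p = poly-const 1
poly-^ {f} (suc k) p = poly-* p (poly-^ k p)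

square<2^ : ∀ i → (5 + i) * (5 + i) < 2 ^ (5 + i)
square<2^ zero    = m≤m+n 26 6
square<2^ (suc i) = begin-strict
  (6 + i) * (6 + i)                       ≤⟨ m≤m+n _ (14 + (8 * i + i * i)) ⟩
  (6 + i) * (6 + i) + (14 + (8 * i + i * i))
    ≡⟨ solve 1 (λ i → (con 6 :+ i) :* (con 6 :+ i) :+ (con 14 :+ (con 8 :* i :+ i :* i))
                   := con 2 :* ((con 5 :+ i) :* (con 5 :+ i))) refl i ⟩
  2 * ((5 + i) * (5 + i))                 <⟨ *-monoʳ-< 2 (square<2^ i) ⟩
  2 * 2 ^ (5 + i)                         ∎
  where
  open ≤-Reasoning
  open +-*-Solver

-- At `m = 2 ^ j` it suffices that `C * suc j < 2 ^ j`. The choice `j = 5 + (C + b)` gives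
-- `C * suc j ≤ j * j`, and `square<2^` does the rest.
poly<exp : ∀ {f} → PolyBounded f → ∀ b → ∃ λ m → b ≤ m × f m < 2 ^ m
poly<exp {f} (C ,ₚ p) b = 2 ^ j , ≤-trans (m≤n+m b (5 + C)) (<⇒≤ (n<2^n j)) ,
  ≤-<-trans (p j) (^-monoʳ-< 2 (s≤s (s≤s z≤n)) (≤-<-trans le (square<2^ (C + b))))
  where
  j j' : ℕ
  j  = 5 + (C + b)
  j' = 4 + (C + b)
  le : C * suc j ≤ j * j
  le = begin
    C * suc j   ≡⟨ *-suc C j ⟩
    C + C * j   ≤⟨ +-mono-≤ (≤-trans (m≤m+n C b) (m≤n+m (C + b) 5)) (*-monoˡ-≤ j (≤-trans (m≤m+n C b) (m≤n+m (C + b) 4))) ⟩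
    j + j' * j  ∎
    where open ≤-Reasoning

wordsUpTo : ℕ → List Word
wordsUpTo zero    = [] ∷ []
wordsUpTo (suc k) = [] ∷ cartesianProductWith _∷_ (false ∷ true ∷ []) (wordsUpTo k)

wordsUpTo-complete : ∀ k w → length w ≤ k → w ∈ wordsUpTo k
wordsUpTo-complete zero    []      le = here refl
wordsUpTo-complete (suc k) []      le = here refl
wordsUpTo-complete (suc k) (b ∷ w) (s≤s le) =
  there (∈-cartesianProductWith⁺ _∷_ (bool b) (wordsUpTo-complete k w le))
  where
  bool : ∀ b → b ∈ false ∷ true ∷ []
  bool false = here refl
  bool true  = there (here refl)

listsUpTo : ℕ → List Word → List (List Word)
listsUpTo zero    ws = [] ∷ []
listsUpTo (suc k) ws = [] ∷ cartesianProductWith _∷_ ws (listsUpTo k ws)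

listsUpTo-complete : ∀ k {ws} Z → length Z ≤ k → All (_∈ ws) Z → Z ∈ listsUpTo k ws
listsUpTo-complete zero    []      le       al       = here refl
listsUpTo-complete (suc k) []      le       al       = here refl
listsUpTo-complete (suc k) (q ∷ Z) (s≤s le) (m ∷ al) =
  there (∈-cartesianProductWith⁺ _∷_ m (listsUpTo-complete k Z le al))

opts : List Opt
opts = none ∷ kill ∷ side false ∷ side true ∷ []

opts-complete : ∀ o → o ∈ opts
opts-complete none         = here refl
opts-complete kill         = there (here refl)
opts-complete (side false) = there (there (here refl))
opts-complete (side true)  = there (there (there (here refl)))

pairIndex : ℕ → Bool → ℕ × ℕ
pairIndex g false = unpair (proj₁ (unpair g))
pairIndex g true  = unpair (proj₂ (unpair g))

pairMach : ℕ → Bool → OTM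
pairMach g i = mach (proj₁ (pairIndex g i))

pairExp : ℕ → Bool → ℕ
pairExp g i = proj₂ (pairIndex g i)

pair-surjective : ∀ (M : Bool → OTM) (k : Bool → ℕ) →
  ∃ λ g → ∀ i → M i ≈ pairMach g i × pairMach g i ≈ M i × pairExp g i ≡ k i
pair-surjective M k = g , good
  where
  e : Bool → ℕ
  e i = proj₁ (mach-surjective (M i) 0)
  g = pair (pair (e false) (k false)) (pair (e true) (k true))
  index : ∀ i → pairIndex g i ≡ (e i , k i)
  index false rewrite unpair-pair (pair (e false) (k false)) (pair (e true) (k true)) = unpair-pair _ _
  index true  rewrite unpair-pair (pair (e false) (k false)) (pair (e true) (k true)) = unpair-pair _ _
  good : ∀ i → M i ≈ pairMach g i × pairMach g i ≈ M i × pairExp g i ≡ k i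
  good i = subst (λ p → M i ≈ mach (proj₁ p) × mach (proj₁ p) ≈ M i × proj₂ p ≡ k i) (sym (index i))
    (proj₁ (proj₂ (proj₂ (mach-surjective (M i) 0))) , proj₂ (proj₂ (proj₂ (mach-surjective (M i) 0))) , refl)

stagePair : ℕ → ℕ
stagePair s = proj₁ (unpair s)

stageMach : ℕ → OTM
stageMach s = mach (proj₁ (unpair (proj₂ (unpair s))))

stageExp : ℕ → ℕ
stageExp s = proj₂ (unpair (proj₂ (unpair s)))

stage-surjective : ∀ g M k → ∃ λ s → stagePair s ≡ g × M ≈ stageMach s × stageMach s ≈ M × stageExp s ≡ k
stage-surjective g M k with mach-surjective M 0
... | e , _ , M≈ , ≈M = s , cong proj₁ eq , subst (λ p → M ≈ mach (proj₁ p)) (sym eq') M≈ ,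
      subst (λ p → mach (proj₁ p) ≈ M) (sym eq') ≈M , cong proj₂ eq'
  where
  s   = pair g (pair e k)
  eq  = unpair-pair g (pair e k)
  eq' = trans (cong (λ p → unpair (proj₂ p)) eq) (unpair-pair e k)

module StageAt (s m : ℕ) = Stage (pairMach (stagePair s)) (pairExp (stagePair s)) (stageMach s) (stageExp s) (stagePair s) m

reserve-poly : ∀ s → PolyBounded (StageAt.reserve s)
reserve-poly s = poly-+ (poly-* l+1 (poly-* (poly-* l+1 (poly-* l+1 l+1)) l+1)) (poly-+ lP lP)
  where
  kF = stageExp s
  k = pairExp (stagePair s)
  TP : PolyBounded (StageAt.T s)
  TP = poly-+ (poly-^ kF poly-id) (poly-const kF)
  XP : PolyBounded (StageAt.X s)
  XP = poly-+ (poly-+ (poly-const 1) poly-id) TP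
  lP : PolyBounded (StageAt.l s)
  lP = poly-+ TP (poly-+ (poly-+ (poly-^ (k false) XP) (poly-const (k false)))
                         (poly-+ (poly-^ (k true) XP) (poly-const (k true))))
  l+1 : PolyBounded (λ m → suc (StageAt.l s m))
  l+1 = poly-+ (poly-const 1) lP

abstract
  roomyLength : ∀ s b → ∃ λ m → b ≤ m × StageAt.reserve s m < 2 ^ m
  roomyLength s b = poly<exp (reserve-poly s) b

Candidate : Set
Candidate = Word × Opt × List Word

module Search (s m : ℕ) (O : Oracle) where
  open StageAt s m hiding (z)

  Passes : Candidate → Set
  Passes (n , o , Z) = Test O n o Z

  passes? : ∀ c → Dec (Passes c)
  passes? (n , o , Z) = map′ (λ { (a , b , c) → test a b c }) (λ { (test a b c) → a , b , c })
    ((length n ≟ m) ×-dec ((length Z <? 2 ^ m) ×-dec verdict? o _ n))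

  candidates : List Candidate
  candidates = cartesianProduct (wordsUpTo m) (cartesianProduct opts (listsUpTo (2 ^ m) (wordsUpTo (suc l))))

  abstract
    -- `stage` provides a candidate under a double negation; the list is finite and the test
    -- decidable, so one is actually found.
    search : reserve < 2 ^ m → ∃ λ c → Passes c
    search room = let c , _ , p = find (decidable-stable (any? passes? candidates) passing) in c , p
      where
      passing : ¬ ¬ Any Passes candidates
      passing np = stage O room λ { (n , o , Z , short , t) →
        np (lose (∈-cartesianProduct⁺ (wordsUpTo-complete m n (≤-reflexive (Test.lengthₙ t)))
                   (∈-cartesianProduct⁺ (opts-complete o)
                     (listsUpTo-complete (2 ^ m) Z (<⇒≤ (Test.few t)) (All.map (wordsUpTo-complete (suc l) _) short)))) t) }

-- The limit oracle

-- A live block keeps its input out of at least one of the two diagonal sets.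
Live : Oracle → Word → Set
Live O v = ∃ λ i → ∃ λ y → length y ≡ length v × O (freeWord i v y) ≡ true

freeWord-length : ∀ i v y → length y ≡ length v → length (freeWord i v y) ≡ 2 + (length v + length v)
freeWord-length i v y eq = cong (2 +_) (length-inter v y eq)

unhitSide : ∀ o v* v → (o ≡ kill × v ≡ v*) ⊎ ∃ λ i → ∀ y → length y ≡ length v → ¬ Hit o v* (freeWord i v y)
unhitSide none v* v = inj₂ (false , λ { y eq (() , _) })
unhitSide kill v* v with v ≟ʷ v*
... | yes eq = inj₁ (refl , eq)
... | no neq = inj₂ (false , λ { y eq (_ , h) → neq (trans (sym (evens-inter v y eq)) h) })
unhitSide (side false) v* v = inj₂ (true , λ { y eq (() , _) })
unhitSide (side true)  v* v = inj₂ (false , λ { y eq (() , _) })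

module Next (s : ℕ) (O : Oracle) (b : ℕ) where

  m : ℕ
  m = proj₁ (roomyLength s b)

  b≤m : b ≤ m
  b≤m = proj₁ (proj₂ (roomyLength s b))

  g : ℕ
  g = stagePair s

  open StageAt s m public using (T; X; l; Acc; Verdict; final; result; final-local; acc-local; result-length)

  chosen : ∃ λ c → Search.Passes s m O c
  chosen = Search.search s m O (proj₂ (proj₂ (roomyLength s b)))

  z : ℕ
  z = suc (m + m)

  open Extend O z g public using (ext; ext-low; ext-hit; ext-true)

  n : Word
  n = proj₁ (proj₁ chosen)

  o : Opt
  o = proj₁ (proj₂ (proj₁ chosen))

  Z : List Word
  Z = proj₂ (proj₂ (proj₁ chosen))

  O' : Oracle
  O' = ext n o Z

  -- Freezes every bit on which the verdict depends and the whole block of `n`.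
  b' : ℕ
  b' = l + (2 + ((g + suc m) + (g + suc m)))

  b<b' : b < b'
  b<b' = ≤-trans (s≤s b≤m) (≤-trans (m≤n+m (suc m) g) (≤-trans (m≤m+n _ (g + suc m)) (≤-trans (m≤n+m _ 2) (m≤n+m _ l))))

  l≤b' : l ≤ b'
  l≤b' = m≤m+n l _

  coherent : ∀ q → length q ≤ b → O' q ≡ O q
  coherent q le = ext-low n o Z q (≤-trans le (≤-trans b≤m (≤-trans (m≤m+n m m) (n≤1+n _))))

  passes : StageAt.Test s m O n o Z
  passes = proj₂ chosen

  n-length : length n ≡ m
  n-length = StageAt.Test.lengthₙ passes

  block-length : length (tag g n) ≡ g + suc m
  block-length = trans (length-tag g n) (cong (λ j → g + suc j) n-length)

  block-word : ∀ i y → length y ≡ length (tag g n) → length (freeWord i (tag g n) y) ≡ 2 + ((g + suc m) + (g + suc m))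
  block-word i y eq = trans (freeWord-length i (tag g n) y eq) (cong (λ j → 2 + (j + j)) block-length)

  block-low : ∀ i y → length y ≡ length (tag g n) → length (freeWord i (tag g n) y) ≤ b'
  block-low i y eq = ≤-trans (≤-reflexive (block-word i y eq)) (m≤n+m _ l)

  block-high : ∀ i y → length y ≡ length (tag g n) → z < length (freeWord i (tag g n) y)
  block-high i y eq = ≤-trans (s≤s (s≤s (+-mono-≤ le le))) (≤-reflexive (sym (block-word i y eq)))
    where
    le : m ≤ g + suc m
    le = ≤-trans (n≤1+n m) (m≤n+m (suc m) g)

  side-false : ∀ i y → o ≡ side i → length y ≡ length (tag g n) → O' (freeWord i (tag g n) y) ≡ false
  side-false i y eq len = ext-hit n o Z _ (block-high i y len)
    (subst (λ o → Hit o (tag g n) (freeWord i (tag g n) y)) (sym eq) (same i , evens-inter (tag g n) y len))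
    where
    same : ∀ i → hits (side i) i ≡ true
    same false = refl
    same true  = refl

  verdict-local : ∀ {A} → (∀ q → length q ≤ l → V O' q ≡ A q) → Verdict o A n
  verdict-local {A} ag = go o (StageAt.Test.verdict passes)
    where
    eq : final A n ≡ final (V O') n
    eq = final-local ag n
    x≤ : length (result A n) ≤ X
    x≤ = result-length A n n-length
    acc→ : ∀ i → Acc i (V O') (result (V O') n) → Acc i A (result A n)
    acc→ i a = acc-local ag i _ x≤ (subst (λ c → Acc i (V O') (output c)) (sym eq) a)
    acc← : ∀ i → Acc i A (result A n) → Acc i (V O') (result (V O') n)
    acc← i a = subst (λ c → Acc i (V O') (output c)) eq (acc-local (λ q le → sym (ag q le)) i _ x≤ a)
    go : ∀ o → Verdict o (V O') n → Verdict o A n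
    go none     na            = subst (λ c → ¬ Accepting (stageMach s) c) (sym eq) na
    go kill     (ac , r₀ , r₁) = subst (Accepting (stageMach s)) (sym eq) ac ,
                                (λ a → r₀ (acc← false a)) , (λ a → r₁ (acc← true a))
    go (side i) (ac , a)      = subst (Accepting (stageMach s)) (sym eq) ac , acc→ i a

  -- A block up to `z` is unchanged. A higher block that is not killed has an unhit side, and that
  -- side has more bits than `Z` has words; the true bit found there may differ from the old one.
  live : ∀ v → Live O v → Live O' v ⊎ (o ≡ kill × v ≡ tag g n)
  live v (i , y , len , tr) with length (freeWord i v y) ≤? z
  ... | yes le = inj₁ (i , y , len , trans (ext-low n o Z _ le) tr)
  ... | no nle with unhitSide o (tag g n) v
  ...   | inj₁ k = inj₂ k
  ...   | inj₂ (j , unhit) = inj₁ (j , y' , len' , ext-true n o Z _ high notin (unhit y' len'))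
    where
    m≤v : m ≤ length v
    m≤v = ≮⇒≥ λ lt → nle (≤-trans (≤-reflexive (freeWord-length i v y len))
            (≤-trans (s≤s (≤-reflexive (sym (+-suc (length v) (length v))))) (s≤s (+-mono-≤ (<⇒≤ lt) lt))))
    guess : Word → Word
    guess u = odds (drop 2 u)
    few : length (map guess Z) < 2 ^ length v
    few = <-≤-trans (≤-<-trans (≤-reflexive (length-map guess Z)) (StageAt.Test.few passes)) (^-monoʳ-≤ 2 m≤v)
    choice = fresh (length v) (map guess Z) few
    y' = proj₁ choice
    len' = proj₁ (proj₂ choice)
    high : z < length (freeWord j v y')
    high = ≤-trans (s≤s (s≤s (+-mono-≤ m≤v m≤v))) (≤-reflexive (sym (freeWord-length j v y' len')))
    notin : freeWord j v y' ∉ Z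
    notin mem = proj₂ (proj₂ choice) (subst (_∈ map guess Z) (odds-inter v y' len') (∈-map⁺ guess mem))

seq : ℕ → Oracle × ℕ
-- All bits are true at first, so every block is live.
seq zero    = (λ _ → true) , 0
seq (suc s) = Next.O' s (proj₁ (seq s)) (proj₂ (seq s)) , Next.b' s (proj₁ (seq s)) (proj₂ (seq s))

oracleAt : ℕ → Oracle
oracleAt s = proj₁ (seq s)

frozen : ℕ → ℕ
frozen s = proj₂ (seq s)

module At (s : ℕ) = Next s (oracleAt s) (frozen s)

s≤frozen : ∀ s → s ≤ frozen s
s≤frozen zero    = z≤n
s≤frozen (suc s) = ≤-trans (s≤s (s≤frozen s)) (At.b<b' s)

frozen-stays : ∀ s d q → length q ≤ frozen s → length q ≤ frozen (d + s) × oracleAt (d + s) q ≡ oracleAt s q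
frozen-stays s zero    q le = le , refl
frozen-stays s (suc d) q le with frozen-stays s d q le
... | le' , eq = ≤-trans le' (<⇒≤ (At.b<b' (d + s))) , trans (At.coherent (d + s) q le') eq

-- The bit of `q` is final from stage `length q` on, by `s≤frozen`.
limit : Oracle
limit q = oracleAt (length q) q

limit-agree : ∀ s q → length q ≤ frozen s → limit q ≡ oracleAt s q
limit-agree s q le = trans
  (sym (proj₂ (frozen-stays (length q) s q (s≤frozen (length q)))))
  (trans (cong (λ j → oracleAt j q) (+-comm s (length q))) (proj₂ (frozen-stays s (length q) q le)))

live-or-killed : ∀ s v → Live (oracleAt s) v ⊎ ∃ λ s' → At.o s' ≡ kill × v ≡ tag (stagePair s') (At.n s')
live-or-killed zero    v = inj₁ (false , v , refl , refl)
live-or-killed (suc s) v with live-or-killed s v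
... | inj₂ k = inj₂ k
... | inj₁ lv with At.live s v lv
...   | inj₁ lv' = inj₁ lv'
...   | inj₂ k   = inj₂ (s , k)

limit-live : ∀ v → Live limit v ⊎ ∃ λ s → At.o s ≡ kill × v ≡ tag (stagePair s) (At.n s)
-- The stage number equals the length of the words in the block, so the block is frozen.
limit-live v with live-or-killed (2 + (length v + length v)) v
... | inj₂ k = inj₂ k
... | inj₁ (i , y , len , tr) = inj₁ (i , y , len , trans (limit-agree (2 + (length v + length v)) _
        (≤-trans (≤-reflexive (freeWord-length i v y len)) (s≤frozen (2 + (length v + length v))))) tr)

A∞ : ℕ → Bool
A∞ = ⌜ V limit ⌝

limit-verdict : ∀ s → At.Verdict s (At.o s) (V limit) (At.n s)
limit-verdict s = At.verdict-local s λ q le → V-local (frozen (suc s))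
  (λ q le → sym (limit-agree (suc s) q le)) q (≤-trans le (At.l≤b' s))

-- The diagonal pair against a given disjoint pair

module Diagonal (P : Bool → Lang) (coNP : ∀ i → InCoNP A∞ (P i)) (disjoint : ∀ n → ¬ (P false n × P true n)) where

  M : Bool → OTM
  M i = proj₁ (coNP i)

  index : ∃ λ g → ∀ i → M i ≈ pairMach g i × pairMach g i ≈ M i × pairExp g i ≡ proj₁ (proj₁ (proj₂ (coNP i)))
  index = pair-surjective M (λ i → proj₁ (proj₁ (proj₂ (coNP i))))

  G : ℕ
  G = proj₁ index

  AccClocked : ℕ → Bool → Word → Set
  AccClocked g i x = AccIn (pairMach g i) A∞ (length x ^ pairExp g i + pairExp g i) x

  clocked-bound : ∀ i → TimeBound (pairMach G i) A∞ (λ m → m ^ pairExp G i + pairExp G i)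
  clocked-bound i with proj₂ index i
  ... | _ , ≈M , eq = subst (λ k → TimeBound (pairMach G i) A∞ (λ m → m ^ k + k)) (sym eq)
                        (cast-timeBound ≈M {T = λ m → m ^ k₀ + k₀} (proj₂ (proj₁ (proj₂ (coNP i)))))
    where k₀ = proj₁ (proj₁ (proj₂ (coNP i)))

  rejected⇒∈ : ∀ i n → ¬ AccClocked G i (encode n) → P i n
  rejected⇒∈ i n rej = Equivalence.from (proj₂ (proj₂ (coNP i)) n) λ a →
    rej (accepts⇒accIn (λ m → m ^ pairExp G i + pairExp G i) n (clocked-bound i) (cast-accepts (proj₁ (proj₂ index i)) n a))

  accepted⇒∉ : ∀ i n → AccClocked G i (encode n) → ¬ P i n
  accepted⇒∉ i n acc p = Equivalence.to (proj₂ (proj₂ (coNP i)) n) p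
    (cast-accepts (proj₁ (proj₂ (proj₂ index i))) n (accIn⇒accepts _ n acc))

  not-both-rejected : ∀ {g} → g ≡ G → ∀ x → ¬ AccClocked g false x → ¬ AccClocked g true x → ⊥
  not-both-rejected refl x r₀ r₁ = disjoint (decode x) (from false r₀ , from true r₁)
    where
    from : ∀ i → ¬ AccClocked G i x → P i (decode x)
    from i r = rejected⇒∈ i (decode x) (subst (λ w → ¬ AccClocked G i w) (sym (encode-decode x)) r)

  P' : Bool → Lang
  P' i n = ¬ Accepts (Guesser.N G i) A∞ n

  P'-coNP : ∀ i → InCoNP A∞ (P' i)
  P'-coNP i = Guesser.N G i , Guesser.guesser-poly G i A∞ , λ n → mk⇔ (λ p → p) (λ p → p)

  V-freeWord : ∀ i v y → A∞ (decode (freeWord i v y)) ≡ limit (freeWord i v y)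
  V-freeWord i v y = trans (cong (V limit) (encode-decode (freeWord i v y))) (V-free limit (i ∷ inter v y))

  -- A block that is not live was killed at some stage. By its tag, that stage dealt with the given
  -- pair, and then both machines reject one word, against disjointness.
  P'-disjoint : ∀ n → ¬ (P' false n × P' true n)
  P'-disjoint n (p₀ , p₁) with limit-live (tag G (encode n))
  ... | inj₁ (i , y , len , tr) = p i (Guesser.guesser-complete G i A∞ n y len (trans (V-freeWord i _ y) tr))
    where
    p : ∀ i → P' i n
    p false = p₀
    p true  = p₁
  ... | inj₂ (s , k , eq) with tag-injective G (stagePair s) eq | subst (λ o → At.Verdict s o (V limit) (At.n s)) k (limit-verdict s)
  ...   | e | _ , r₀ , r₁ = not-both-rejected (sym e) (At.result s (V limit) (At.n s)) r₀ r₁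

  -- Some stage treats exactly this pair, reduction machine and clock, and each verdict is refuted:
  -- `none` because the reduction halts in time, `kill` by disjointness, `side i` because `ν` is in
  -- `P' i` while machine `i` accepts `f ν`.
  irreducible : ¬ Reduces A∞ (P' false) (P' true) (P false) (P true)
  irreducible (f , (F , det , (kF , tb) , computes) , red₀ , red₁)
    with stage-surjective G F kF
  ... | s , eqG , F≈ , ≈F , eqK = contradict (At.o s) refl (limit-verdict s)
    where
    n̂ = At.n s
    ν = decode n̂

    reached : ∃ λ c → At.final s (V limit) n̂ ≡ c × Accepting (stageMach s) c × output c ≡ encode (f ν)
    reached with computes ν
    ... | t , c , ss , ac , out = castConfig F≈ {A∞} c , ran , trans (_≈_.kindEq F≈ _) ac , out
      where
      t≤T : t ≤ At.T s
      t≤T = ≤-trans (timeBound-steps (λ m → m ^ kF + kF) ν tb ss)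
        (≤-reflexive (cong₂ (λ m k → m ^ k + k) (trans (cong length (encode-decode n̂)) (At.n-length s)) (sym eqK)))
      ran : run (stageMach s) A∞ (At.T s) (initW (stageMach s) n̂) ≡ castConfig F≈ {A∞} c
      ran = run-steps (stageMach s) (cast-deterministic ≈F {A∞} det)
              (subst (λ w → Steps (stageMach s) A∞ t (initW (stageMach s) w) _) (encode-decode n̂) (cast-initSteps F≈ ν ss))
              (trans (_≈_.kindEq F≈ _) ac) t≤T

    result≡ : At.result s (V limit) n̂ ≡ encode (f ν)
    result≡ with reached
    ... | c , eq , _ , out = trans (cong output eq) out

    acc⇒ : ∀ i → At.Acc s i (V limit) (At.result s (V limit) n̂) → AccClocked G i (encode (f ν))
    acc⇒ i = subst₂ (λ g x → AccClocked g i x) eqG result≡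

    side∈ : ∀ i → At.o s ≡ side i → P' i ν
    side∈ i eq acc with Guesser.guesser-sound G i A∞ ν acc
    ... | y , len , tr with trans (sym tr) (trans (V-freeWord i (tag G (encode ν)) y) blocked)
      where
      tag≡ : tag G (encode ν) ≡ tag (stagePair s) n̂
      tag≡ = cong₂ tag (sym eqG) (encode-decode n̂)
      len' : length y ≡ length (tag (stagePair s) n̂)
      len' = trans len (cong length tag≡)
      blocked : limit (freeWord i (tag G (encode ν)) y) ≡ false
      blocked = trans (cong (λ v → limit (freeWord i v y)) tag≡)
        (trans (limit-agree (suc s) _ (At.block-low s i y len')) (At.side-false s i y eq len'))
    ...   | ()

    contradict : ∀ o → At.o s ≡ o → At.Verdict s o (V limit) n̂ → ⊥
    contradict none eq na with reached
    ... | c , e , ac , _ = na (subst (Accepting (stageMach s)) (sym e) ac)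
    contradict kill eq (_ , r₀ , r₁) = not-both-rejected eqG (At.result s (V limit) n̂) r₀ r₁
    contradict (side false) eq (_ , a) = accepted⇒∉ false (f ν) (acc⇒ false a) (red₀ ν (side∈ false eq))
    contradict (side true)  eq (_ , a) = accepted⇒∉ true (f ν) (acc⇒ true a) (red₁ ν (side∈ true eq))

theorem5p1 : Σ (ℕ → Bool) λ V →
    (¬ Σ Lang (λ U → Σ Lang (λ W → CompletePair V U W)))
    × (∀ (L : Lang) → InE V L ⇔ InNE V L)
theorem5p1 = A∞ , noComplete , λ X → mk⇔ (λ { (D , _ , e , ok) → D , e , ok }) (NE⊆E limit)
  where
  noComplete : ¬ Σ Lang (λ U → Σ Lang (λ W → CompletePair A∞ U W))
  noComplete (U , W , (cU , cW , dis) , complete) =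
    irreducible (complete _ _ (P'-coNP false , P'-coNP true , P'-disjoint))
    where
    P : Bool → Lang
    P false = U
    P true  = W
    coNP : ∀ i → InCoNP A∞ (P i)
    coNP false = cU
    coNP true  = cW
    open Diagonal P coNP dis
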